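{- RED-BLUE SEPARATION, on input graphs of order $n$ whose vertices belong to the color classes $R$ (red vertices) and $B$ (blue vertices), can be solved in time $O(n^{3\min\{|R|,|B|\}})$ on triangle-free graphs and in time $O(n^{\Delta\min\{|R|,|B|\}})$ on graphs of maximum degree $\Delta$.
   Context: All graphs are finite, simple and undirected. $N[x]$ denotes the closed neighborhood of $x$. A graph is twin-free if no two distinct vertices have the same closed neighborhood. A red-blue coloring of $G$ is a map $c:V(G)\to\{\text{red},\text{blue}\}$. A red-blue separating set of $(G,c)$ is a set $S\subseteq V(G)$ such that $N[r]\cap S\neq N[b]\cap S$ for every red vertex $r$ and every blue vertex $b$. For $G$ twin-free, $\mathrm{sep}_{RB}(G,c)$ is the smallest size of a red-blue separating set of $(G,c)$. RED-BLUE SEPARATION: given a red-blue colored twin-free graph $(G,c)$ and an integer $k$, decide whether $\mathrm{sep}_{RB}(G,c)\leq k$. -}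

module Defs where

open import Level using (0ℓ)
open import Data.Bool using (if_then_else_)
open import Data.Fin using (Fin; toℕ; _<?_)
import Data.Fin as Fin
open import Data.Fin.Subset using (Subset; _∩_; ∣_∣)
open import Data.Integer using (ℤ; +_; -[1+_])
import Data.Integer as ℤ
open import Data.List
  using (List; []; _∷_; _++_; length; map; filter; foldr; concatMap; allFin; cartesianProduct)
open import Data.Nat using (ℕ; zero; suc; _+_; _*_; _∸_; _⊓_; _⊔_; _≤_; _≟_)
open import Data.Product using (_×_; _,_; Σ-syntax; ∃-syntax)
open import Data.Vec using (tabulate)
open import Relation.Binary
  using (Rel; Symmetric; Irreflexive; Decidable; DecidableEquality)
open import Relation.Binary.PropositionalEquality using (_≡_; _≢_; refl)
open import Relation.Nullary using (¬_; does; yes; no; _⊎-dec_; _×-dec_)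

record Graph (n : ℕ) : Set₁ where
  infix 4 _~_ _~?_
  field
    _~_    : Rel (Fin n) 0ℓ
    _~?_   : Decidable _~_
    ~-sym  : Symmetric _~_
    ~-irr  : Irreflexive _≡_ _~_

  N[_] : Fin n → Subset n
  N[ x ] = tabulate λ v → does ((v Fin.≟ x) ⊎-dec (x ~? v))

  degree : Fin n → ℕ
  degree x = length (filter (x ~?_) (allFin n))

  -- The graph of order 0 gets maximum degree 0.
  maxDegree : ℕ
  maxDegree = foldr _⊔_ 0 (map degree (allFin n))

  TwinFree : Set
  TwinFree = ∀ x y → x ≢ y → N[ x ] ≢ N[ y ]

  TriangleFree : Set
  TriangleFree = ∀ x y z → ¬ (x ~ y × y ~ z × z ~ x)

  -- Every edge is listed once, with its smaller endpoint first.
  edges : List (Fin n × Fin n)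
  edges = filter (λ (u , v) → (u <? v) ×-dec (u ~? v))
                 (cartesianProduct (allFin n) (allFin n))

data Colour : Set where
  red blue : Colour

infix 4 _≟ᶜ_

_≟ᶜ_ : DecidableEquality Colour
red  ≟ᶜ red  = yes refl
red  ≟ᶜ blue = no λ ()
blue ≟ᶜ red  = no λ ()
blue ≟ᶜ blue = yes refl

Colouring : ℕ → Set
Colouring n = Fin n → Colour

colourClass : ∀ {n} → Colouring n → Colour → List (Fin n)
colourClass {n} c a = filter (λ v → c v ≟ᶜ a) (allFin n)

module _ {n : ℕ} (G : Graph n) (c : Colouring n) where
  open Graph G

  Separating : Subset n → Set
  Separating S = ∀ r b → c r ≡ red → c b ≡ blue → N[ r ] ∩ S ≢ N[ b ] ∩ S

  -- SepRB s says that sep_RB(G,c) = s.  When G is twin-free the full vertex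
  -- set is separating, so there is exactly one such s.
  SepRB : ℕ → Set
  SepRB s = (∃[ S ] Separating S × ∣ S ∣ ≡ s)
          × (∀ S → Separating S → s ≤ ∣ S ∣)

record Instance : Set₁ where
  field
    order     : ℕ
    graph     : Graph order
    twinFree  : Graph.TwinFree graph
    colouring : Colouring order
    k         : ℤ

  open Graph graph public using (edges; maxDegree; TriangleFree)

  R B : List (Fin order)
  R = colourClass colouring red
  B = colourClass colouring blue

  minClass : ℕ
  minClass = length R ⊓ length B

  Yes : Set
  Yes = ∃[ s ] SepRB graph colouring s × + s ℤ.≤ k

-- Random access machines under the uniform cost criterion, presented as a
-- structured language.  Words are natural numbers.  Multiplication is not
-- a primitive: at unit cost it would make the model unreasonably strong.
Reg Addr : Set
Reg  = ℕ
Addr = ℕ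

infix  22 _≔_ _≔_⊕_ _≔_⊖_ _≔[_] [_]≔_
infixr 21 _⨾_

data Program : Set where
  skip          : Program
  _≔_           : Reg → ℕ → Program
  _≔_⊕_         : Reg → Reg → Reg → Program
  _≔_⊖_         : Reg → Reg → Reg → Program
  _≔[_]         : Reg → Reg → Program
  [_]≔_         : Reg → Reg → Program
  _⨾_           : Program → Program → Program
  ifz_then_else_ : Reg → Program → Program → Program
  whilenz_loop_  : Reg → Program → Program

record State : Set where
  constructor ⟪_,_⟫
  field
    reg : Reg → ℕ
    mem : Addr → ℕ

open State public

infixl 25 _[_↦_]

_[_↦_] : (ℕ → ℕ) → ℕ → ℕ → (ℕ → ℕ)
(f [ i ↦ w ]) j = if does (j ≟ i) then w else f j

infix 4 ⟨_,_⟩⇓[_]_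

-- ⟨ P , σ ⟩⇓[ t ] τ : started in σ, P halts in τ after t steps.
data ⟨_,_⟩⇓[_]_ : Program → State → ℕ → State → Set where

  ⇓skip  : ∀ {σ} → ⟨ skip , σ ⟩⇓[ 1 ] σ

  ⇓const : ∀ {x w ρ μ} →
           ⟨ x ≔ w , ⟪ ρ , μ ⟫ ⟩⇓[ 1 ] ⟪ ρ [ x ↦ w ] , μ ⟫

  ⇓add   : ∀ {x y z ρ μ} →
           ⟨ x ≔ y ⊕ z , ⟪ ρ , μ ⟫ ⟩⇓[ 1 ] ⟪ ρ [ x ↦ ρ y + ρ z ] , μ ⟫

  ⇓sub   : ∀ {x y z ρ μ} →
           ⟨ x ≔ y ⊖ z , ⟪ ρ , μ ⟫ ⟩⇓[ 1 ] ⟪ ρ [ x ↦ ρ y ∸ ρ z ] , μ ⟫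

  ⇓load  : ∀ {x y ρ μ} →
           ⟨ x ≔[ y ] , ⟪ ρ , μ ⟫ ⟩⇓[ 1 ] ⟪ ρ [ x ↦ μ (ρ y) ] , μ ⟫

  ⇓store : ∀ {x y ρ μ} →
           ⟨ [ x ]≔ y , ⟪ ρ , μ ⟫ ⟩⇓[ 1 ] ⟪ ρ , μ [ ρ x ↦ ρ y ] ⟫

  ⇓seq   : ∀ {P Q σ τ υ s t} →
           ⟨ P , σ ⟩⇓[ s ] τ → ⟨ Q , τ ⟩⇓[ t ] υ →
           ⟨ P ⨾ Q , σ ⟩⇓[ s + t ] υ

  ⇓ifz   : ∀ {x P Q σ τ t} → reg σ x ≡ 0 →
           ⟨ P , σ ⟩⇓[ t ] τ →
           ⟨ ifz x then P else Q , σ ⟩⇓[ suc t ] τ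

  ⇓ifnz  : ∀ {x P Q σ τ t} → reg σ x ≢ 0 →
           ⟨ Q , σ ⟩⇓[ t ] τ →
           ⟨ ifz x then P else Q , σ ⟩⇓[ suc t ] τ

  ⇓exit  : ∀ {x P σ} → reg σ x ≡ 0 →
           ⟨ whilenz x loop P , σ ⟩⇓[ 1 ] σ

  ⇓loop  : ∀ {x P σ τ υ s t} → reg σ x ≢ 0 →
           ⟨ P , σ ⟩⇓[ s ] τ → ⟨ whilenz x loop P , τ ⟩⇓[ t ] υ →
           ⟨ whilenz x loop P , σ ⟩⇓[ suc (s + t) ] υ

encodeℤ : ℤ → List ℕ
encodeℤ (+ m)    = 0 ∷ m ∷ []
encodeℤ -[1+ m ] = 1 ∷ suc m ∷ []

-- Storing the lengths lets |R|, |B| and |E| be read in constant time, so that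
-- bounds n ^ e make sense also when e is 0.
encodeList : ∀ {A : Set} → (A → List ℕ) → List A → List ℕ
encodeList f xs = length xs ∷ concatMap f xs

encodeVertex : ∀ {n} → Fin n → List ℕ
encodeVertex v = toℕ v ∷ []

encodeEdge : ∀ {n} → Fin n × Fin n → List ℕ
encodeEdge (u , v) = toℕ u ∷ toℕ v ∷ []

encode : Instance → List ℕ
encode I = order ∷ encodeℤ k
  ++ encodeList encodeVertex R
  ++ encodeList encodeVertex B
  ++ encodeList encodeEdge edges
  where open Instance I

contents : List ℕ → Addr → ℕ
contents []       _       = 0
contents (w ∷ ws) zero    = w
contents (w ∷ ws) (suc i) = contents ws i

initial : Instance → State
initial I = ⟪ (λ _ → 0) , contents (encode I) ⟫

-- The answer is left in register 0.
record RunsWithin (P : Program) (I : Instance) (T : ℕ) : Set where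
  field
    steps    : ℕ
    final    : State
    run      : ⟨ P , initial I ⟩⇓[ steps ] final
    bounded  : steps ≤ T
    accepts  : Instance.Yes I → reg final 0 ≡ 1
    rejects  : ¬ Instance.Yes I → reg final 0 ≡ 0

-- P and C serve all instances of the class 𝒞, whatever the order, the colour
-- classes and the maximum degree, on all of which f may depend.
RedBlueSeparationOn_SolvableInO_ : (Instance → Set) → (Instance → ℕ) → Set₁
RedBlueSeparationOn 𝒞 SolvableInO f =
  Σ[ P ∈ Program ] Σ[ C ∈ ℕ ] (∀ I → 𝒞 I → RunsWithin P I (C * f I))

{-# OPTIONS --safe #-}

-- Let h be the size of the smaller colour class.  If every vertex x has a set of
-- at most d vertices telling x apart from all other vertices, the union of these
-- sets over the smaller class is separating, so sep_RB ≤ d h.  One may take d = 3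
-- on triangle-free graphs: x and two of its neighbours, or x and a vertex telling
-- it apart from its only neighbour.  One may take d = Δ as soon as there is an
-- edge: if deg x < Δ, take x and, for each neighbour, a vertex telling it apart
-- from x.  If deg x = Δ, the neighbours of x do, unless all of them lie in N[b] for
-- some b ≠ x; then b is not adjacent to x, by twin-freeness, and {x, b} does.
--
-- Hence the answer is yes when k ≥ d h or k ≥ n, and otherwise it is found by
-- testing all sets of at most k ≤ d h - 1 vertices.  A test takes time
-- O(|R| |B| (k + 1)) = O(h n (k + 1)) on the adjacency matrix, and since sets are
-- enumerated as decreasing sequences there are O((k + 1) n^k / k!) of them.  The
-- factorial absorbs the polynomial factors, which leaves O(n^(d h)).  Without
-- edges a separating set contains a whole colour class, so sep_RB = h.
module Submission where

open import Defs
open import Data.Bool using (Bool; true; false; if_then_else_; not; _∧_; _∨_)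
import Data.Bool as Bool
open import Data.Bool.ListAction using (all)
open import Data.Bool.Properties using (∧-assoc; ∧-identityʳ; ∨-assoc; ∨-identityʳ; ∨-zeroʳ; ∧-zeroʳ; ¬-not)
open import Data.Empty using (⊥-elim)
open import Data.Fin using (Fin; toℕ; fromℕ<; zero; suc)
import Data.Fin as Fin
open import Data.Fin.Properties using (toℕ<n; toℕ-injective; toℕ-fromℕ<; fromℕ<-toℕ; any?; all?; ¬∀⟶∃¬)
open import Data.Fin.Subset using (Subset; ∣_∣; _∩_)
open import Data.Fin.Subset.Properties using (anySubset?; ∣p∣≤n)
open import Data.Integer using (ℤ; +_; -[1+_])
import Data.Integer as ℤ
import Data.Integer.Properties as ℤ
open import Data.List using (List; []; _∷_; _++_; length; map; filter; foldr; concatMap; allFin; cartesianProduct; tabulate)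
open import Data.List.Membership.Propositional using (_∈_; lose)
open import Data.List.Membership.Propositional.Properties using (∈-filter⁺; ∈-filter⁻; ∈-allFin; ∈-concatMap⁺; ∈-map⁺; ∈-cartesianProduct⁺)
open import Data.List.Relation.Unary.Any using (here; there)
open import Data.List.Relation.Unary.All using (All; []; _∷_)
open import Data.List.Properties using (∷-injective; length-map; length-++; length-tabulate; length-filter)
open import Data.Nat hiding (compare)
open import Data.Nat.Properties
open import Data.Nat.Tactic.RingSolver using (solve-∀)
open import Data.Product using (_×_; _,_; proj₁; proj₂; ∃-syntax)
open import Data.Sum using (_⊎_; inj₁; inj₂; [_,_]′)
import Data.Sum as Sum
open import Data.Unit using (⊤; tt)
open import Data.Vec using (lookup)
import Data.Vec as Vec
import Data.Vec.Properties as Vec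
open import Function using (_∘_; id; case_of_)
open import Relation.Binary using (tri<; tri≈; tri>)
open import Relation.Binary.PropositionalEquality
open import Relation.Nullary using (¬_; Dec; does; yes; no; _×-dec_; _⊎-dec_; _→-dec_; ¬?)
open import Relation.Nullary.Decidable using (dec-true; dec-false; decidable-stable)

-- Running times of programs

-- One program and one constant serve all instances, so nothing that grows with k or h may hide in
-- the constant, while the exponent d h may be tiny. It is 0 when a colour class is empty and, for d
-- = Δ, when there is no edge; the bound is then `n ^ 0`, so these cases must be settled in constant
-- time, from the lengths stored in the input. Once both classes are inhabited and there is an edge,
-- d h ≥ 2, because twin-freeness then forces Δ ≥ 2. This pays for the n² steps that build the
-- adjacency matrix and compute Δ.
--
-- Stopping at k ≥ n matters for the count as well: for i ≤ k ≤ n there are at most n^k / k! sets of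
-- size i, whereas for k > n the factor k! could not be gained. That factor has to absorb up to (k +
-- 1)^3: one k + 1 for the number of sizes, one for the cost of a test, and one for h.
--
-- The machine neither multiplies nor compares. Row addresses and the product d h arise by repeated
-- addition, and minima, maxima and comparisons from truncated subtraction.

record Runs (P : Program) (σ : State) (t : ℕ) (Q : State → Set) : Set where
  constructor runs
  field
    {steps} : ℕ
    {final} : State
    run     : ⟨ P , σ ⟩⇓[ steps ] final
    bounded : steps ≤ t
    post    : Q final

within : ∀ {P σ s t Q} → s ≤ t → Runs P σ s Q → Runs P σ t Q
within s≤t (runs r b q) = runs r (≤-trans b s≤t) q

weaken : ∀ {P σ t Q Q′} → (∀ τ → Q τ → Q′ τ) → Runs P σ t Q → Runs P σ t Q′
weaken f (runs r b q) = runs r b (f _ q)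

infixr 4 _then_

_then_ : ∀ {P P′ σ s t Q Q′} → Runs P σ s Q → (∀ τ → Q τ → Runs P′ τ t Q′) →
         Runs (P ⨾ P′) σ (s + t) Q′
runs r b q then f with f _ q
... | runs r′ b′ q′ = runs (⇓seq r r′) (+-mono-≤ b b′) q′

branch : ∀ {x P P′ σ t Q} →
         (reg σ x ≡ 0 → Runs P σ t Q) → (reg σ x ≢ 0 → Runs P′ σ t Q) →
         Runs (ifz x then P else P′) σ (suc t) Q
branch {x} {σ = σ} f g with reg σ x ≟ 0
... | yes e with runs r b q ← f e = runs (⇓ifz e r) (s≤s b) q
... | no ¬e with runs r b q ← g ¬e = runs (⇓ifnz ¬e r) (s≤s b) q

Straight : Program → Set
Straight (P ⨾ P′)                = Straight P × Straight P′
Straight (ifz _ then _ else _)   = Data.Empty.⊥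
Straight (whilenz _ loop _)      = Data.Empty.⊥
Straight _                       = ⊤

exec : Program → State → State
exec (x ≔ w)     σ = ⟪ reg σ [ x ↦ w ] , mem σ ⟫
exec (x ≔ y ⊕ z) σ = ⟪ reg σ [ x ↦ reg σ y + reg σ z ] , mem σ ⟫
exec (x ≔ y ⊖ z) σ = ⟪ reg σ [ x ↦ reg σ y ∸ reg σ z ] , mem σ ⟫
exec (x ≔[ y ])  σ = ⟪ reg σ [ x ↦ mem σ (reg σ y) ] , mem σ ⟫
exec ([ x ]≔ y)  σ = ⟪ reg σ , mem σ [ reg σ x ↦ reg σ y ] ⟫
exec (P ⨾ P′)    σ = exec P′ (exec P σ)
-- This is the meaning of `skip`; on branches and loops it is a default value, and `Straight`
-- excludes them.
exec _           σ = σ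

size : Program → ℕ
size (P ⨾ P′) = size P + size P′
size _        = 1

exec-run : ∀ P {σ} → Straight P → ⟨ P , σ ⟩⇓[ size P ] exec P σ
exec-run skip        _       = ⇓skip
exec-run (x ≔ w)     _       = ⇓const
exec-run (x ≔ y ⊕ z) _       = ⇓add
exec-run (x ≔ y ⊖ z) _       = ⇓sub
exec-run (x ≔[ y ])  _       = ⇓load
exec-run ([ x ]≔ y)  _       = ⇓store
exec-run (P ⨾ P′)    (s , s′) = ⇓seq (exec-run P s) (exec-run P′ s′)

-- For a concrete program `Straight P` reduces to a product of unit types, so the implicit argument
-- is filled in by eta, and `Q (exec P σ)` is checked by evaluation.
block : ∀ {P σ Q} {_ : Straight P} → Q (exec P σ) → Runs P σ (size P) Q
block {P} {_} {_} {s} q = runs (exec-run P s) ≤-refl q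

-- Inv i is the invariant with i iterations to go; the body decrements the
-- counter x itself.
countdown : ∀ {x P c} (Inv : ℕ → State → Set) →
  (∀ i σ → reg σ x ≡ suc i → Inv (suc i) σ → Runs P σ c (λ τ → reg τ x ≡ i × Inv i τ)) →
  ∀ i σ → reg σ x ≡ i → Inv i σ →
  Runs (whilenz x loop P) σ (suc i * suc c) (Inv 0)
countdown Inv body zero σ e inv = runs (⇓exit e) (s≤s z≤n) inv
countdown Inv body (suc i) σ e inv
  with runs r b (e′ , inv′) ← body i σ e inv
  with runs r′ b′ q ← countdown Inv body i _ e′ inv′
  = runs (⇓loop (λ z → case trans (sym e) z of λ ()) r r′) (s≤s (+-mono-≤ b b′)) q

-- A product rather than a function on registers, so that updating a concrete
-- register from N on preserves it definitionally.
Agree : ℕ → State → State → Set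
Agree zero    σ τ = ⊤
Agree (suc N) σ τ = Agree N σ τ × reg τ N ≡ reg σ N

-- The bound on `i` is a Boolean test: for a concrete register it reduces to the unit type and need
-- not be supplied.
kept : ∀ N σ τ → Agree N σ τ → ∀ i → {_ : Bool.T (i <ᵇ N)} → reg τ i ≡ reg σ i
kept (suc N) σ τ (ag , e) i {p} with i ≟ N
... | yes refl = e
... | no i≢N   = kept N σ τ ag i {<⇒<ᵇ (≤∧≢⇒< (≤-pred (<ᵇ⇒< i (suc N) p)) i≢N)}

agree-refl : ∀ N σ → Agree N σ σ
agree-refl zero    σ = tt
agree-refl (suc N) σ = agree-refl N σ , refl

agree-trans : ∀ N σ τ υ → Agree N σ τ → Agree N τ υ → Agree N σ υ
agree-trans zero    _ _ _ _        _          = tt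
agree-trans (suc N) σ τ υ (a , e) (a′ , e′) = agree-trans N σ τ υ a a′ , trans e′ e

agree-fewer : ∀ k N σ τ → Agree (k + N) σ τ → Agree N σ τ
agree-fewer zero    N σ τ ag       = ag
agree-fewer (suc k) N σ τ (ag , _) = agree-fewer k N σ τ ag

update-same : ∀ f i w → (f [ i ↦ w ]) i ≡ w
update-same f i w rewrite dec-true (i ≟ i) refl = refl

update-other : ∀ f {i j} w → j ≢ i → (f [ i ↦ w ]) j ≡ f j
update-other f {i} {j} w j≢i rewrite dec-false (j ≟ i) j≢i = refl

-- Highest address first, so that loops counting down consume the list from its head and a push onto
-- the stack is a cons.
arr : (Addr → ℕ) → Addr → ℕ → List ℕ
arr μ a zero    = []
arr μ a (suc i) = μ (a + i) ∷ arr μ a i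

arr-cong : ∀ {μ μ′} a i → (∀ j → j < i → μ (a + j) ≡ μ′ (a + j)) → arr μ a i ≡ arr μ′ a i
arr-cong a zero    _ = refl
arr-cong a (suc i) f = cong₂ _∷_ (f i ≤-refl) (arr-cong a i λ j j<i → f j (m≤n⇒m≤1+n j<i))

∈-arr⁻ : ∀ {μ a v} i → v ∈ arr μ a i → ∃[ j ] j < i × v ≡ μ (a + j)
∈-arr⁻ (suc i) (here e)  = i , ≤-refl , e
∈-arr⁻ (suc i) (there p) with j , j<i , e ← ∈-arr⁻ i p = j , m≤n⇒m≤1+n j<i , e

∈-arr⁺ : ∀ {μ a} i {j} → j < i → μ (a + j) ∈ arr μ a i
∈-arr⁺ (suc i) {j} j<1+i with j ≟ i
... | yes refl = here refl
... | no j≢i   = there (∈-arr⁺ i (≤∧≢⇒< (≤-pred j<1+i) j≢i))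

-- Nested loops add a set-up cost at every level. This turns such a bound back into a product, at
-- the price of a larger constant.
absorb : ∀ a x c → a + suc x * c ≤ suc x * (a + c)
absorb a x c = begin
  a + suc x * c           ≤⟨ +-monoˡ-≤ (suc x * c) (m≤m+n a (x * a)) ⟩
  suc x * a + suc x * c   ≡⟨ *-distribˡ-+ (suc x) a c ⟨
  suc x * (a + c)         ∎
  where open ≤-Reasoning

-- The remaining run of the loop is part of the postcondition. The search loop has no decreasing
-- counter, so `countdown` does not apply to it, and its run is assembled along the search tree
-- instead.
iterate : ∀ {x P σ s t Q} → reg σ x ≢ 0 →
          Runs P σ s (λ τ → Runs (whilenz x loop P) τ t Q) →
          Runs (whilenz x loop P) σ (suc (s + t)) Q
iterate x≢0 (runs r b (runs r′ b′ q)) = runs (⇓loop x≢0 r r′) (s≤s (+-mono-≤ b b′)) q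

arr-push : ∀ {μ a i v L} → arr μ a i ≡ L → arr (μ [ a + i ↦ v ]) a (suc i) ≡ v ∷ L
arr-push {μ} {a} {i} {v} refl = cong₂ _∷_ (update-same μ (a + i) v)
  (arr-cong a i λ j j<i → update-other μ v λ e → <-irrefl (+-cancelˡ-≡ a j i e) j<i)

-- Testing a candidate set

-- Register 0 holds 0 until the answer is written at the very end, so that
-- until then it also serves as the constant 0.
ans rOne #V #R #B aR aB #E aE aT aM rK rH aS rMul lvl rem val found : Reg
ans   = 0
rOne  = 1
#V    = 2
#R    = 3
#B    = 4
aR    = 5
aB    = 6
#E    = 7
aE    = 8
aT    = 9
aM    = 10
rK    = 11
rH    = 12
aS    = 13
rMul  = 14
lvl   = 16
rem   = 17
val   = 18
found = 19

ctr row ok ctr′ row′ diff ctr″ tmp u₁ u₂ : Reg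
ctr   = 20
row   = 21
ok    = 22
ctr′  = 23
row′  = 24
diff  = 25
ctr″  = 26
tmp   = 27
u₁    = 28
u₂    = 29

-- The absolute difference in terms of truncated subtraction. Summing it over a candidate set
-- reduces the comparison of two matrix rows to a single test against zero.
dist : ℕ → ℕ → ℕ
dist a b = (a ∸ b) + (b ∸ a)

distance : (Addr → ℕ) → ℕ → ℕ → List ℕ → ℕ
distance μ r r′ []      = 0
distance μ r r′ (v ∷ L) = dist (μ (r + v)) (μ (r′ + v)) + distance μ r r′ L

compareStep : Program
compareStep =
  (ctr″ ≔ ctr″ ⊖ rOne) ⨾
  (tmp ≔ aS ⊕ ctr″) ⨾ u₁ ≔[ tmp ] ⨾
  -- `row′` is read before `row`, because `u₁` holds the vertex until the second entry overwrites
  -- it.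
  (tmp ≔ row′ ⊕ u₁) ⨾ u₂ ≔[ tmp ] ⨾
  (tmp ≔ row ⊕ u₁) ⨾ u₁ ≔[ tmp ] ⨾
  (tmp ≔ u₁ ⊖ u₂) ⨾ (diff ≔ diff ⊕ tmp) ⨾
  (tmp ≔ u₂ ⊖ u₁) ⨾ (diff ≔ diff ⊕ tmp)

compare : Program
compare = (diff ≔ 0 ⨾ (ctr″ ≔ lvl ⊕ ans)) ⨾ (whilenz ctr″ loop compareStep)

pairStep : Program
pairStep =
  ((ctr′ ≔ ctr′ ⊖ rOne) ⨾
   (tmp ≔ aB ⊕ ctr′) ⨾ tmp ≔[ tmp ] ⨾
   (tmp ≔ aT ⊕ tmp) ⨾ row′ ≔[ tmp ]) ⨾
  compare ⨾
  (ifz diff then ok ≔ 0 else skip)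

rowStep : Program
rowStep =
  ((ctr ≔ ctr ⊖ rOne) ⨾
   (tmp ≔ aR ⊕ ctr) ⨾ tmp ≔[ tmp ] ⨾
   (tmp ≔ aT ⊕ tmp) ⨾ row ≔[ tmp ] ⨾
   (ctr′ ≔ #B ⊕ ans)) ⨾
  (whilenz ctr′ loop pairStep)

check : Program
check =
  (ok ≔ 1 ⨾ (ctr ≔ #R ⊕ ans)) ⨾
  (whilenz ctr loop rowStep) ⨾
  (ifz ok then skip else found ≔ 1)

bit : Bool → ℕ
bit true  = 1
bit false = 0

-- The register contents are variables, so that matching on `refl` can replace them all at once by
-- the values that the invariant predicts.
compareStep-arith : ∀ μ {d c s r r′ i S R R′ total} →
  c ≡ i → s ≡ S → r ≡ R → r′ ≡ R′ →
  d + distance μ R R′ (arr μ S (suc i)) ≡ total →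
  let x = μ (r + μ (s + c)) ; y = μ (r′ + μ (s + c)) in
  (d + (x ∸ y)) + (y ∸ x) + distance μ R R′ (arr μ S i) ≡ total
compareStep-arith μ {d} refl refl refl refl e = trans (arith d _ _ _) e
  where
  arith : ∀ a b c e → a + b + c + e ≡ a + (b + c + e)
  arith = solve-∀

pred-ctr : ∀ {c o i} → c ≡ suc i → o ≡ 1 → c ∸ o ≡ i
pred-ctr refl refl = refl

compare-runs : ∀ σ → reg σ rOne ≡ 1 → reg σ ans ≡ 0 →
  Runs compare σ (2 + suc (reg σ lvl) * 12)
    λ τ → Agree 25 σ τ × mem τ ≡ mem σ ×
          reg τ diff ≡ distance (mem σ) (reg σ row) (reg σ row′) (arr (mem σ) (reg σ aS) (reg σ lvl))
compare-runs σ e₁ e₀ =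
  block {P = diff ≔ 0 ⨾ (ctr″ ≔ lvl ⊕ ans)}
    {Q = λ τ → Inv p τ × reg τ ctr″ ≡ p}
    ((agree-refl 25 σ , refl , refl) , trans (cong (_+_ p) e₀) (+-identityʳ p))
  then λ τ (inv , e) →
  weaken (λ τ (ag , m , d) → ag , m , trans (sym (+-identityʳ _)) d)
    (countdown Inv step p τ e inv)
  where
  μ = mem σ
  p = reg σ lvl
  S = reg σ aS
  Inv : ℕ → State → Set
  Inv i τ = Agree 25 σ τ × mem τ ≡ μ ×
    reg τ diff + distance μ (reg σ row) (reg σ row′) (arr μ S i)
      ≡ distance μ (reg σ row) (reg σ row′) (arr μ S p)
  step : ∀ i τ → reg τ ctr″ ≡ suc i → Inv (suc i) τ →
         Runs compareStep τ 11 λ τ → reg τ ctr″ ≡ i × Inv i τ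
  step i ⟪ ρ , _ ⟫ e (ag , refl , d) = block
    ( pred-ctr e one
    , ag , refl
    , compareStep-arith μ (pred-ctr e one) (same aS) (same row) (same row′) d )
    where
    same = kept 25 σ ⟪ ρ , μ ⟫ ag
    one : ρ rOne ≡ 1
    one = trans (same rOne) e₁

branch-bit : ∀ {x} b → x ≡ bit b → (x ≡ 0 → b ≡ false) × (x ≢ 0 → b ≡ true)
branch-bit true  refl = (λ ()) , (λ _ → refl)
branch-bit false refl = (λ _ → refl) , (λ ne → ⊥-elim (ne refl))

nonzero : ℕ → Bool
nonzero d = not (d ≡ᵇ 0)

nonzero-zero : ∀ {x d} → x ≡ d → x ≡ 0 → nonzero d ≡ false
nonzero-zero refl refl = refl

nonzero-suc : ∀ {x d} → x ≡ d → x ≢ 0 → nonzero d ≡ true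
nonzero-suc {zero}  refl ne = ⊥-elim (ne refl)
nonzero-suc {suc _} refl _  = refl

-- The entry value `o₀` is arbitrary because `ok` is set only once, before the loop over the red
-- vertices, and later steps can only lower it.
pairs-run : ∀ σ o₀ → reg σ rOne ≡ 1 → reg σ ans ≡ 0 →
  reg σ ok ≡ bit o₀ → reg σ ctr′ ≡ reg σ #B →
  Runs (whilenz ctr′ loop pairStep) σ (suc (reg σ #B) * (suc (reg σ lvl) * 22))
    λ τ → Agree 22 σ τ × mem τ ≡ mem σ ×
          reg τ ok ≡ bit (o₀ ∧ all (λ b → nonzero (distance (mem σ) (reg σ row) (mem σ (reg σ aT + b))
                                              (arr (mem σ) (reg σ aS) (reg σ lvl))))
                                   (arr (mem σ) (reg σ aB) (reg σ #B)))
pairs-run σ o₀ e₁ e₀ eok ectr =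
  within (*-monoʳ-≤ (suc (reg σ #B)) (absorb 1 p 21))
  (weaken (λ τ (ag , m , o , eo , e) →
             ag , m , trans eo (cong bit (trans (sym (∧-identityʳ o)) e)))
  (countdown Inv step (reg σ #B) σ ectr (agree-refl 22 σ , refl , o₀ , eok , refl)))
  where
  μ = mem σ
  p = reg σ lvl
  L = arr μ (reg σ aS) p
  f : ℕ → Bool
  f b = nonzero (distance μ (reg σ row) (μ (reg σ aT + b)) L)
  Inv : ℕ → State → Set
  Inv i τ = Agree 22 σ τ × mem τ ≡ μ × ∃[ o ] reg τ ok ≡ bit o ×
    o ∧ all f (arr μ (reg σ aB) i) ≡ o₀ ∧ all f (arr μ (reg σ aB) (reg σ #B))
  step : ∀ i τ → reg τ ctr′ ≡ suc i → Inv (suc i) τ →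
         Runs pairStep τ (suc p * 21) λ τ → reg τ ctr′ ≡ i × Inv i τ
  step i τ₀@(⟪ ρ , _ ⟫) e (ag , refl , o , eo , eall) =
    within (≤-trans (≤-reflexive eqt) (absorb 9 p 12)) (
    block {Q = λ τ → τ ≡ τ₁} refl
    then λ where
      _ refl → compare-runs τ₁ one (trans (same ans) e₀)
        then λ { τ₂ (ag₂ , m₂ , d₂) →
          let same₂ = kept 25 τ₁ τ₂ ag₂
              d≡ = trans d₂ deq
              ag′ = agree-trans 22 σ τ₁ τ₂ ag (agree-fewer 3 22 τ₁ τ₂ ag₂)
              c≡ = trans (same₂ ctr′) (pred-ctr e one)
          in branch
            (λ z → block {P = ok ≔ 0}
              (c≡ , ag′ , m₂ , false , refl ,
               trans (sym (∧-zeroʳ o))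
                 (trans (cong (λ q → o ∧ (q ∧ all f (arr μ (reg σ aB) i))) (sym (nonzero-zero d≡ z))) eall)))
            (λ z → block {P = skip}
              (c≡ , ag′ , m₂ , o , trans (same₂ ok) eo ,
               trans (cong (λ q → o ∧ (q ∧ all f (arr μ (reg σ aB) i))) (sym (nonzero-suc d≡ z))) eall)) })
    where
    same = kept 22 σ τ₀ ag
    one : ρ rOne ≡ 1
    one = trans (same rOne) e₁
    τ₁ : State
    τ₁ = exec ((ctr′ ≔ ctr′ ⊖ rOne) ⨾ (tmp ≔ aB ⊕ ctr′) ⨾ tmp ≔[ tmp ] ⨾
               (tmp ≔ aT ⊕ tmp) ⨾ row′ ≔[ tmp ]) τ₀
    eqt : 5 + ((2 + suc (ρ lvl) * 12) + 2) ≡ 9 + suc p * 12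
    eqt = trans (cong (λ q → 5 + ((2 + suc q * 12) + 2)) (same lvl)) (arith (suc p * 12))
      where
      arith : ∀ a → 5 + ((2 + a) + 2) ≡ 9 + a
      arith = solve-∀
    deq : distance μ (ρ row) (μ (ρ aT + μ (ρ aB + (ρ ctr′ ∸ ρ rOne)))) (arr μ (ρ aS) (ρ lvl))
        ≡ distance μ (reg σ row) (μ (reg σ aT + μ (reg σ aB + i))) L
    deq rewrite same row {_} | same aT {_} | same aB {_} | same aS {_} | same lvl {_} | pred-ctr e one = refl

separatesIn : (Addr → ℕ) → Addr → Addr → ℕ → Addr → ℕ → List ℕ → Bool
separatesIn μ t aR nR aB nB L =
  all (λ r → all (λ b → nonzero (distance μ (μ (t + r)) (μ (t + b)) L)) (arr μ aB nB)) (arr μ aR nR)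

checked : State → Bool
checked σ = separatesIn (mem σ) (reg σ aT) (reg σ aR) (reg σ #R) (reg σ aB) (reg σ #B)
                        (arr (mem σ) (reg σ aS) (reg σ lvl))

-- `found` is updated by disjunction: a success is recorded and the search goes on regardless. The
-- 33 is the 12 of a comparison step with the set-up costs 9 + 1, 6 and 5 of the enclosing levels
-- absorbed.
check-runs : ∀ σ f₀ → reg σ rOne ≡ 1 → reg σ ans ≡ 0 → reg σ found ≡ bit f₀ →
  Runs check σ (suc (reg σ #R) * (suc (reg σ #B) * (suc (reg σ lvl) * 33)))
    λ τ → Agree 19 σ τ × mem τ ≡ mem σ × reg τ found ≡ bit (f₀ ∨ checked σ)
check-runs σ f₀ e₁ e₀ ef =
  within (begin
    2 + (suc nR * suc (suc nB * (suc p * 28)) + 2)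
      ≡⟨ arith (suc nR * suc (suc nB * (suc p * 28))) ⟩
    4 + suc nR * suc (suc nB * (suc p * 28))
      ≤⟨ absorb 4 nR _ ⟩
    suc nR * (5 + suc nB * (suc p * 28))
      ≤⟨ *-monoʳ-≤ (suc nR) (≤-trans (absorb 5 nB _) (*-monoʳ-≤ (suc nB) (absorb 5 p 28))) ⟩
    suc nR * (suc nB * (suc p * 33)) ∎)
  (block {P = ok ≔ 1 ⨾ (ctr ≔ #R ⊕ ans)}
    {Q = λ τ → Inv nR τ × reg τ ctr ≡ nR}
    ((agree-refl 20 σ , refl , true , refl , refl) , trans (cong (_+_ nR) e₀) (+-identityʳ nR))
  then λ τ (inv , e) → countdown Inv step nR τ e inv
  then λ { τ (ag , m , o , eo , e) →
    let o≡ = trans (sym (∧-identityʳ o)) e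
        ef′ = trans (kept 20 σ τ ag found) ef
    in branch
      (λ z → block {P = skip}
        ( agree-fewer 1 19 σ τ ag , m
        , trans ef′ (cong bit (trans (sym (∨-identityʳ f₀))
            (cong (f₀ ∨_) (trans (sym (proj₁ (branch-bit o eo) z)) o≡))))))
      (λ z → block {P = found ≔ 1}
        ( agree-fewer 1 19 σ τ ag , m
        , cong bit (trans (sym (∨-zeroʳ f₀))
            (cong (f₀ ∨_) (trans (sym (proj₂ (branch-bit o eo) z)) o≡))))) })
  where
  open ≤-Reasoning
  μ = mem σ
  p = reg σ lvl
  nR = reg σ #R
  nB = reg σ #B
  L = arr μ (reg σ aS) p
  arith : ∀ a → 2 + (a + 2) ≡ 4 + a
  arith = solve-∀
  g : ℕ → Bool
  g r = all (λ b → nonzero (distance μ (μ (reg σ aT + r)) (μ (reg σ aT + b)) L)) (arr μ (reg σ aB) nB)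
  Inv : ℕ → State → Set
  Inv i τ = Agree 20 σ τ × mem τ ≡ μ × ∃[ o ] reg τ ok ≡ bit o ×
    o ∧ all g (arr μ (reg σ aR) i) ≡ all g (arr μ (reg σ aR) nR)
  step : ∀ i τ → reg τ ctr ≡ suc i → Inv (suc i) τ →
         Runs rowStep τ (suc nB * (suc p * 28)) λ τ → reg τ ctr ≡ i × Inv i τ
  step i τ₀@(⟪ ρ , _ ⟫) e (ag , refl , o , eo , eall) =
    within (≤-trans (≤-reflexive eqt) (≤-trans (absorb 6 nB _) (*-monoʳ-≤ (suc nB) (absorb 6 p 22)))) (
    block {Q = λ τ → τ ≡ τ₁} refl
    then λ where
      _ refl → weaken
        (λ τ₂ (ag₂ , m₂ , o₂) →
          trans (kept 22 τ₁ τ₂ ag₂ ctr) (pred-ctr e one)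
          , agree-trans 20 σ τ₁ τ₂ ag (agree-fewer 2 20 τ₁ τ₂ ag₂) , m₂ , _ , o₂
          , trans (∧-assoc o _ _) (trans (cong (λ q → o ∧ (q ∧ all g (arr μ (reg σ aR) i))) geq) eall))
        (pairs-run τ₁ o one (trans (same ans) e₀) eo
          (trans (cong (_+_ (ρ #B)) (trans (same ans) e₀)) (+-identityʳ (ρ #B)))))
    where
    same = kept 20 σ τ₀ ag
    one : ρ rOne ≡ 1
    one = trans (same rOne) e₁
    τ₁ : State
    τ₁ = exec ((ctr ≔ ctr ⊖ rOne) ⨾ (tmp ≔ aR ⊕ ctr) ⨾ tmp ≔[ tmp ] ⨾
               (tmp ≔ aT ⊕ tmp) ⨾ row ≔[ tmp ] ⨾ (ctr′ ≔ #B ⊕ ans)) τ₀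
    eqt : 6 + suc (ρ #B) * (suc (ρ lvl) * 22) ≡ 6 + suc nB * (suc p * 22)
    eqt = cong₂ (λ a b → 6 + suc a * (suc b * 22)) (same #B) (same lvl)
    geq : all (λ b → nonzero (distance μ (μ (ρ aT + μ (ρ aR + (ρ ctr ∸ ρ rOne)))) (μ (ρ aT + b))
                                (arr μ (ρ aS) (ρ lvl)))) (arr μ (ρ aB) (ρ #B))
        ≡ g (μ (reg σ aR + i))
    geq rewrite same #B {_} | same aT {_} | same aB {_} | same aS {_} | same lvl {_}
              | same aR {_} | pred-ctr e one = refl

-- Backtracking search

visit : Program
visit = check ⨾ (ifz rem then skip else
  -- The pushed value is not yet an element but an exclusive bound: the loop lowers it before the
  -- next test.
  ((tmp ≔ aS ⊕ lvl) ⨾ [ tmp ]≔ val ⨾ (lvl ≔ lvl ⊕ rOne) ⨾ (rem ≔ rem ⊖ rOne)))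

advance : Program
advance =
  ((tmp ≔ lvl ⊖ rOne) ⨾ (tmp ≔ aS ⊕ tmp) ⨾ val ≔[ tmp ]) ⨾
  -- A top entry 0 leaves no smaller vertex to try.
  (ifz val then ((lvl ≔ lvl ⊖ rOne) ⨾ (rem ≔ rem ⊕ rOne))
   else (((val ≔ val ⊖ rOne) ⨾ [ tmp ]≔ val) ⨾ visit))

-- The stack at aS holds a strictly decreasing sequence of vertices, the top
-- entry being moreover an upper bound on the values still to be tried for it.
search : Program
search =
  (lvl ≔ 0 ⨾ found ≔ 0 ⨾ (rem ≔ rK ⊕ ans) ⨾ (val ≔ #V ⊕ ans)) ⨾
  visit ⨾
  (whilenz lvl loop advance)

-- The number of iterations until a top entry of value y, with j levels free above it, has been
-- popped. In the last clause the three summands are the lowering of the entry, the subtree above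
-- the new value, and the remaining smaller values.
visits : ℕ → ℕ → ℕ
visits j       zero    = 1
visits zero    (suc y) = 1 + visits zero y
visits (suc j) (suc y) = 1 + (visits j y + visits (suc j) y)

module _ (chk : List ℕ → Bool) where

  -- The disjunction of all tests made while the entry above `L` sinks from its bound to 0, by the
  -- same recursion as `visits`.
  foundBelow : ℕ → ℕ → List ℕ → Bool
  foundBelow j       zero    L = false
  foundBelow zero    (suc y) L = chk (y ∷ L) ∨ foundBelow zero y L
  foundBelow (suc j) (suc y) L = (chk (y ∷ L) ∨ foundBelow j y (y ∷ L)) ∨ foundBelow (suc j) y L

  foundFrom : ℕ → ℕ → List ℕ → Bool
  foundFrom zero    x L = chk L
  foundFrom (suc j) x L = chk L ∨ foundBelow j x L

-- The extra 1 is the visit of the empty set, which precedes the loop.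
total : ℕ → ℕ → ℕ
total zero    n = 1
total (suc j) n = 1 + visits j n

-- The test enters as a function `chk` of the list alone. The hypothesis `chk-correct` says that on
-- every state that preserves the parameters and the memory below the stack, the machine's test
-- depends only on the stack.
module Search (σ₀ : State) (chk : List ℕ → Bool)
  (e₁ : reg σ₀ rOne ≡ 1) (e₀ : reg σ₀ ans ≡ 0)
  (chk-correct : ∀ σ L → Agree 16 σ₀ σ → (∀ a → a < reg σ₀ aS → mem σ a ≡ mem σ₀ a) →
                 All (_< reg σ₀ #V) L → reg σ lvl ≡ length L →
                 arr (mem σ) (reg σ₀ aS) (length L) ≡ L → checked σ ≡ chk L)
  where

  n S k X K : ℕ
  n = reg σ₀ #V
  S = reg σ₀ aS
  k = reg σ₀ rK
  X = suc (reg σ₀ #R) * (suc (reg σ₀ #B) * (suc k * 33))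
  -- One iteration: the loop test, 3 steps to fetch the top, the branch, 2 steps to lower it, and a
  -- visit in at most X + 5.
  K = 12 + X

  record At (σ : State) (L : List ℕ) (j : ℕ) (f : Bool) : Set where
    constructor at
    field
      agree  : Agree 16 σ₀ σ
      below  : ∀ a → a < S → mem σ a ≡ mem σ₀ a
      level  : reg σ lvl ≡ length L
      left   : reg σ rem ≡ j
      stack  : arr (mem σ) S (length L) ≡ L
      answer : reg σ found ≡ bit f

  store-below : ∀ {μ i v} → (∀ a → a < S → μ a ≡ mem σ₀ a) →
                ∀ a → a < S → (μ [ S + i ↦ v ]) a ≡ mem σ₀ a
  store-below {μ} {i} {v} b a a<S =
    trans (update-other μ v λ e → <-irrefl e (<-≤-trans a<S (m≤m+n S i))) (b a a<S)

  Visited : ℕ → ℕ → List ℕ → Bool → State → Set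
  Visited zero    x L f τ = At τ L 0 f
  Visited (suc j) x L f τ = At τ (x ∷ L) j f

  visit-runs : ∀ σ L j f x → At σ L j f → reg σ val ≡ x → All (_< n) L → length L ≤ k →
               Runs visit σ (X + 5) (Visited j x L (f ∨ chk L))
  visit-runs σ L j f x (at ag b lv lf st an) ev L<n L≤k =
    within time-ok
    (check-runs σ f one zer an then λ { τ (ag′ , m , an′) →
      let same′ = kept 19 σ τ ag′
          agτ = agree-trans 16 σ₀ σ τ ag (agree-fewer 3 16 σ τ ag′)
          bτ = λ a a<S → trans (cong (λ μ → μ a) m) (b a a<S)
          stτ = trans (cong (λ μ → arr μ S (length L)) m) st
          anτ = trans an′ (cong (λ q → bit (f ∨ q)) (chk-correct σ L ag b L<n lv st))
          sameτ = kept 16 σ₀ τ agτ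
      in branch
        (λ z → within (s≤s z≤n) (block {P = skip} (stop j τ
           (trans (sym lf) (trans (sym (same′ rem)) z)) agτ bτ (trans (same′ lvl) lv) z stτ anτ)))
        (λ z → block (go j τ (trans (same′ rem) lf) z agτ bτ (trans (same′ lvl) lv) (trans (same′ val) ev)
                    (trans (sameτ rOne) e₁) (sameτ aS) stτ anτ)) })
    where
    same = kept 16 σ₀ σ ag
    one = trans (same rOne) e₁
    zer = trans (same ans) e₀
    time-ok : suc (reg σ #R) * (suc (reg σ #B) * (suc (reg σ lvl) * 33)) + 5 ≤ X + 5
    time-ok rewrite same #R {_} | same #B {_} | lv =
      +-monoˡ-≤ 5 (*-monoʳ-≤ (suc (reg σ₀ #R)) (*-monoʳ-≤ (suc (reg σ₀ #B)) (*-monoˡ-≤ 33 (s≤s L≤k))))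
    stop : ∀ j τ → j ≡ 0 → Agree 16 σ₀ τ → (∀ a → a < S → mem τ a ≡ mem σ₀ a) →
           reg τ lvl ≡ length L → reg τ rem ≡ 0 → arr (mem τ) S (length L) ≡ L →
           reg τ found ≡ bit (f ∨ chk L) → Visited j x L (f ∨ chk L) τ
    stop j τ refl ag b lv lf st an = at ag b lv lf st an
    go : ∀ j τ → reg τ rem ≡ j → reg τ rem ≢ 0 → Agree 16 σ₀ τ → (∀ a → a < S → mem τ a ≡ mem σ₀ a) →
         reg τ lvl ≡ length L → reg τ val ≡ x → reg τ rOne ≡ 1 → reg τ aS ≡ S →
         arr (mem τ) S (length L) ≡ L → reg τ found ≡ bit (f ∨ chk L) →
         Visited j x L (f ∨ chk L)
           (exec ((tmp ≔ aS ⊕ lvl) ⨾ [ tmp ]≔ val ⨾ (lvl ≔ lvl ⊕ rOne) ⨾ (rem ≔ rem ⊖ rOne)) τ)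
    go zero    τ e ne _ _ _ _ _ _ _ _ = ⊥-elim (ne e)
    go (suc j) τ e _ ag b lv ev e₁ eS st an = at ag
      (λ a a<S → trans (cong (λ q → (mem τ [ q ↦ reg τ val ]) a) addr) (store-below b a a<S))
      (trans (cong₂ _+_ lv e₁) (+-comm _ 1))
      (pred-ctr e e₁)
      (trans (cong₂ (λ q v → arr (mem τ [ q ↦ v ]) S (suc (length L))) addr ev) (arr-push st))
      an
      where
      addr : reg τ aS + reg τ lvl ≡ S + length L
      addr = cong₂ _+_ eS lv

  -- The program has one flat loop, whereas the search is a tree recursion. Passing the rest of the
  -- loop, with its time t, as a continuation reconciles them: the subtree is charged `visits j x`
  -- iterations, and `cont` resumes after its last entry has been popped.
  descend : ∀ x j L f σ {t Q} → At σ (x ∷ L) j f → All (_< n) L → x ≤ n → length L + suc j ≡ k →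
            (∀ τ → At τ L (suc j) (f ∨ foundBelow chk j x L) → Runs (whilenz lvl loop advance) τ t Q) →
            Runs (whilenz lvl loop advance) σ (visits j x * K + t) Q
  pop : ∀ x j L f σ {t Q} → At σ (x ∷ L) j f → x ≡ 0 →
        (∀ τ → At τ L (suc j) f → Runs (whilenz lvl loop advance) τ t Q) →
        Runs (whilenz lvl loop advance) σ (K + t) Q
  lower : ∀ y j L f σ {t Q} → At σ (suc y ∷ L) j f → All (_< n) L → suc y ≤ n → length L + suc j ≡ k →
          (∀ τ → Visited j y (y ∷ L) (f ∨ chk (y ∷ L)) τ → Runs (whilenz lvl loop advance) τ t Q) →
          Runs (whilenz lvl loop advance) σ (K + t) Q

  descend zero j L f σ {t} A L<n x≤n len cont =
    within (≤-reflexive (cong (_+ t) (sym (+-identityʳ K))))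
      (pop zero j L f σ A refl λ τ A′ → cont τ (subst (At τ L (suc j)) (sym (∨-identityʳ f)) A′))
  descend (suc y) zero L f σ {t} A L<n x≤n len cont =
    within (≤-reflexive (sym (+-assoc K (visits 0 y * K) t)))
      (lower y zero L f σ A L<n x≤n len λ τ A′ →
        descend y zero L _ τ A′ L<n (<⇒≤ x≤n) len λ τ A″ →
          cont τ (subst (At τ L 1) (∨-assoc f _ _) A″))
  descend (suc y) (suc j) L f σ {t} A L<n x≤n len cont =
    within (≤-reflexive (arith K (visits j y) (visits (suc j) y) t))
      (lower y (suc j) L f σ A L<n x≤n len λ τ A′ →
        -- The visit has pushed a second `y`, the exclusive bound for the entry above the element
        -- `y`.
        descend y j (y ∷ L) _ τ A′ (x≤n ∷ L<n) (<⇒≤ x≤n) (trans (sym (+-suc (length L) (suc j))) len) λ τ A″ →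
          descend y (suc j) L _ τ A″ L<n (<⇒≤ x≤n) len λ τ A‴ →
            cont τ (subst (At τ L (2 + j))
              (trans (cong (_∨ foundBelow chk (suc j) y L) (∨-assoc f _ _)) (∨-assoc f _ _)) A‴))
    where
    arith : ∀ a b c t → a + (b * a + (c * a + t)) ≡ (1 + (b + c)) * a + t
    arith = solve-∀

  pop x j L f σ {t} A@(at ag b lv lf st an) x≡0 cont =
    within (+-monoˡ-≤ t (≤-trans (m≤n+m 7 5) (m≤m+n 12 X)))
    (iterate (λ z → case trans (sym lv) z of λ ())
      (block {Q = λ τ → τ ≡ τ₁} refl then λ { _ refl → branch
        (λ _ → block (cont _ (at ag b (pred-ctr lv one)
          (trans (cong₂ _+_ lf one) (+-comm j 1)) (proj₂ (∷-injective st)) an)))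
        (λ ne → ⊥-elim (ne top)) }))
    where
    same = kept 16 σ₀ σ ag
    one = trans (same rOne) e₁
    τ₁ : State
    τ₁ = exec ((tmp ≔ lvl ⊖ rOne) ⨾ (tmp ≔ aS ⊕ tmp) ⨾ val ≔[ tmp ]) σ
    top : reg τ₁ val ≡ 0
    top = trans (cong (mem σ) (cong₂ _+_ (same aS) (pred-ctr lv one)))
            (trans (proj₁ (∷-injective st)) x≡0)

  lower y j L f σ {t} A@(at ag b lv lf st an) L<n y<n len cont =
    within (≤-reflexive (arith X t))
    (iterate (λ z → case trans (sym lv) z of λ ())
      (block {Q = λ τ → τ ≡ τ₁} refl then λ { _ refl → branch
        (λ z → ⊥-elim (case trans (sym top) z of λ ()))
        (λ _ → block {Q = λ τ → τ ≡ τ₂} refl then λ { _ refl → weaken (cont)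
          (visit-runs τ₂ (y ∷ L) j f y
            (at ag
              (λ a a<S → trans (cong (λ q → (mem σ [ q ↦ reg τ₁ val ∸ reg σ rOne ]) a) addr)
                           (store-below b a a<S))
              lv lf
              (trans (cong₂ (λ q v → arr (mem σ [ q ↦ v ]) S (suc (length L))) addr new)
                (arr-push (proj₂ (∷-injective st)))) an)
            new (y<n ∷ L<n) (≤-trans (m≤m+n (suc (length L)) j) (≤-reflexive (trans (sym (+-suc (length L) j)) len)))) }) }))
    where
    same = kept 16 σ₀ σ ag
    one = trans (same rOne) e₁
    τ₁ τ₂ : State
    τ₁ = exec ((tmp ≔ lvl ⊖ rOne) ⨾ (tmp ≔ aS ⊕ tmp) ⨾ val ≔[ tmp ]) σ
    τ₂ = exec ((val ≔ val ⊖ rOne) ⨾ [ tmp ]≔ val) τ₁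
    addr : reg τ₁ tmp ≡ S + length L
    addr = cong₂ _+_ (same aS) (pred-ctr lv one)
    top : reg τ₁ val ≡ suc y
    top = trans (cong (mem σ) addr) (proj₁ (∷-injective st))
    new : reg τ₁ val ∸ reg σ rOne ≡ y
    new = pred-ctr top one
    arith : ∀ X t → suc (3 + suc (2 + (X + 5)) + t) ≡ 12 + X + t
    arith = solve-∀

  search-runs : Runs search σ₀ (5 + total k n * K) λ τ →
    reg τ ans ≡ 0 × reg τ found ≡ bit (foundFrom chk k n [])
  search-runs =
    within bound
    (block {Q = λ τ → τ ≡ τ₁} refl then λ { _ refl →
      visit-runs τ₁ [] k false n
        (at (agree-refl 16 σ₀) (λ _ _ → refl) refl (trans (cong (_+_ k) e₀) (+-identityʳ k)) refl refl)
        (trans (cong (_+_ n) e₀) (+-identityʳ n)) [] z≤n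
      then λ τ V → rest k refl τ V })
    where
    τ₁ : State
    τ₁ = exec (lvl ≔ 0 ⨾ found ≔ 0 ⨾ (rem ≔ rK ⊕ ans) ⨾ (val ≔ #V ⊕ ans)) σ₀
    below : ℕ → ℕ
    below zero    = 1
    below (suc j) = visits j n * K + 1
    Done : ℕ → State → Set
    Done j τ = reg τ ans ≡ 0 × reg τ found ≡ bit (foundFrom chk j n [])
    finish : ∀ {j} τ {i} → At τ [] i (foundFrom chk j n []) →
             Runs (whilenz lvl loop advance) τ 1 (Done j)
    finish τ A = runs (⇓exit (At.level A)) ≤-refl
      (trans (kept 16 σ₀ τ (At.agree A) ans) e₀ , At.answer A)
    rest : ∀ j → j ≡ k → ∀ τ → Visited j n [] (chk []) τ →
           Runs (whilenz lvl loop advance) τ (below j) (Done j)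
    rest zero    e τ V = finish {zero} τ V
    rest (suc j) e τ V = descend n j [] _ τ V [] ≤-refl e λ τ A → finish {suc j} τ A
    bound-arith : ∀ X v → X + 5 + (v * (12 + X) + 1) ≤ 1 + (1 + v) * (12 + X)
    bound-arith X v = ≤-trans (m≤m+n _ 7) (≤-reflexive (arith X v))
      where
      arith : ∀ X v → X + 5 + (v * (12 + X) + 1) + 7 ≡ 1 + (1 + v) * (12 + X)
      arith = solve-∀
    total-below : ∀ j → X + 5 + below j ≤ 1 + total j n * K
    total-below zero    = bound-arith X 0
    total-below (suc j) = bound-arith X (visits j n)
    bound : 4 + (X + 5 + below k) ≤ 5 + total k n * K
    bound = +-monoʳ-≤ 4 (total-below k)

-- Adjacency matrix and degrees

tableStep : Program
tableStep = (ctr ≔ ctr ⊖ rOne) ⨾ [ u₂ ]≔ u₁ ⨾ (u₁ ≔ u₁ ⊕ #V) ⨾ (u₂ ≔ u₂ ⊕ rOne)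

-- Computing `A + u * n` afresh would take about u additions at each access; the table makes every
-- matrix entry available in constant time.
table : Program
table = ((u₁ ≔ aM ⊕ ans) ⨾ (u₂ ≔ aT ⊕ ans) ⨾ (ctr ≔ #V ⊕ ans)) ⨾
        (whilenz ctr loop tableStep) ⨾
        -- After n rows `u₁` has reached the end of the matrix, where the stack begins.
        (aS ≔ u₁ ⊕ ans)

mark : Reg → Reg → Program
mark p q = (tmp ≔ aT ⊕ p) ⨾ tmp ≔[ tmp ] ⨾ (tmp ≔ tmp ⊕ q) ⨾ [ tmp ]≔ rOne

edgeStep : Program
edgeStep =
  ((ctr ≔ ctr ⊖ rOne) ⨾
   (tmp ≔ aE ⊕ ctr) ⨾ (tmp ≔ tmp ⊕ ctr) ⨾ u₁ ≔[ tmp ] ⨾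
   (tmp ≔ tmp ⊕ rOne) ⨾ u₂ ≔[ tmp ]) ⨾
  mark u₁ u₂ ⨾ mark u₂ u₁

fillEdges : Program
fillEdges = (ctr ≔ #E ⊕ ans) ⨾ (whilenz ctr loop edgeStep)

diagonalStep : Program
diagonalStep = (ctr ≔ ctr ⊖ rOne) ⨾ mark ctr ctr

fillDiagonal : Program
fillDiagonal = (ctr ≔ #V ⊕ ans) ⨾ (whilenz ctr loop diagonalStep)

sumStep : Program
sumStep = (ctr′ ≔ ctr′ ⊖ rOne) ⨾ (tmp ≔ row ⊕ ctr′) ⨾ tmp ≔[ tmp ] ⨾ (ok ≔ ok ⊕ tmp)

degreeStep : Program
degreeStep =
  ((ctr ≔ ctr ⊖ rOne) ⨾ (tmp ≔ aT ⊕ ctr) ⨾ row ≔[ tmp ] ⨾ ok ≔ 0 ⨾ (ctr′ ≔ #V ⊕ ans)) ⨾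
  (whilenz ctr′ loop sumStep) ⨾
  ((tmp ≔ ok ⊖ rMul) ⨾ (rMul ≔ rMul ⊕ tmp))

largestDegree : Program
largestDegree = (rMul ≔ 0 ⨾ (ctr ≔ #V ⊕ ans)) ⨾ (whilenz ctr loop degreeStep)

plus-zero : ∀ {x y z} → x ≡ y → z ≡ 0 → x + z ≡ y
plus-zero {x} refl refl = +-identityʳ x

table-runs : ∀ σ → reg σ rOne ≡ 1 → reg σ ans ≡ 0 →
  let n = reg σ #V ; T = reg σ aT ; A = reg σ aM in
  Runs table σ (4 + suc n * 5) λ τ →
    Agree 13 σ τ × reg τ aS ≡ A + n * n ×
    (∀ u → u < n → mem τ (T + u) ≡ A + u * n) ×
    (∀ a → a < T ⊎ T + n ≤ a → mem τ a ≡ mem σ a)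
table-runs σ e₁ e₀ =
  within (≤-reflexive (arith (suc n * 5)))
  (block {Q = λ τ → Inv n τ × reg τ ctr ≡ n}
    ((agree-refl 13 σ , 0 , refl , trans (plus-zero refl e₀) (sym (+-identityʳ A))
     , trans (plus-zero refl e₀) (sym (+-identityʳ T)) , (λ _ ()) , (λ _ _ → refl)) , plus-zero refl e₀)
  then λ τ (inv , e) → countdown Inv step n τ e inv
  then λ { τ (ag , d , d≡ , eu₁ , eu₂ , tab , oth) →
    block (ag , trans (plus-zero eu₁ (trans (kept 13 σ τ ag ans) e₀))
                   (cong (λ d → A + d * n) (trans (sym (+-identityʳ d)) d≡))
          , (λ u u<n → tab u (subst (u <_) (trans (sym d≡) (+-identityʳ d)) u<n)) , oth) })
  where
  n = reg σ #V
  T = reg σ aT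
  A = reg σ aM
  arith : ∀ a → 3 + (a + 1) ≡ 4 + a
  arith = solve-∀
  Inv : ℕ → State → Set
  Inv i τ = Agree 13 σ τ × ∃[ d ] d + i ≡ n ×
    reg τ u₁ ≡ A + d * n × reg τ u₂ ≡ T + d ×
    (∀ u → u < d → mem τ (T + u) ≡ A + u * n) ×
    (∀ a → a < T ⊎ T + n ≤ a → mem τ a ≡ mem σ a)
  step : ∀ i τ → reg τ ctr ≡ suc i → Inv (suc i) τ →
         Runs tableStep τ 4 λ τ → reg τ ctr ≡ i × Inv i τ
  step i τ₀@(⟪ ρ , μ ⟫) e (ag , d , d≡ , eu₁ , eu₂ , tab , oth) = block
    ( pred-ctr e one
    , ag , suc d , trans (sym (+-suc d i)) d≡
    , trans (cong₂ _+_ eu₁ (same #V)) (arith′ A (d * n) n)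
    , trans (cong₂ _+_ eu₂ one) (trans (+-assoc T d 1) (cong (_+_ T) (+-comm d 1)))
    , (λ u u<1+d → trans (cong (λ q → (μ [ q ↦ ρ u₁ ]) (T + u)) eu₂) (new u (u ≟ d) u<1+d))
    , (λ a out → trans (update-other μ (ρ u₁) (λ a≡ → outside a out (trans a≡ eu₂))) (oth a out)))
    where
    same = kept 13 σ τ₀ ag
    one = trans (same rOne) e₁
    arith′ : ∀ a b c → a + b + c ≡ a + (c + b)
    arith′ = solve-∀
    new : ∀ u → Dec (u ≡ d) → u < suc d → (μ [ T + d ↦ ρ u₁ ]) (T + u) ≡ A + u * n
    new u (yes refl) _ = trans (update-same μ (T + u) _) eu₁
    new u (no u≢d) u<1+d = trans (update-other μ _ (λ e → u≢d (+-cancelˡ-≡ T u d e)))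
      (tab u (≤∧≢⇒< (≤-pred u<1+d) u≢d))
    outside : ∀ a → a < T ⊎ T + n ≤ a → a ≢ T + d
    outside a (inj₁ a<T) refl = <⇒≱ a<T (m≤m+n T d)
    outside a (inj₂ T+n≤a) refl =
      <⇒≱ (+-monoʳ-< T (≤-trans (s≤s (m≤m+n d i)) (≤-reflexive (trans (sym (+-suc d i)) d≡)))) T+n≤a

-- Instantiated twice: `Good` is adjacency while the edges are marked, and closed adjacency once the
-- diagonal is. `Filled` only bounds the marks from above; that every required mark is present is a
-- postcondition of the loops. The table lies below `A`, so marking never damages it.
module Matrix (n T A : ℕ) (T+n≤A : T + n ≤ A) (Good : ℕ → ℕ → Set) (μ₀ : Addr → ℕ)
              (μ₀-table : ∀ u → u < n → μ₀ (T + u) ≡ A + u * n) where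

  cell : ℕ → ℕ → Addr
  cell u v = A + u * n + v

  cell-<  : ∀ {u v a b} → v < n → u < a → cell u v < cell a b
  cell-< {u} {v} {a} {b} v<n u<a = begin-strict
    A + u * n + v    <⟨ +-monoʳ-< (A + u * n) v<n ⟩
    A + u * n + n    ≡⟨ trans (+-assoc A (u * n) n) (cong (_+_ A) (+-comm (u * n) n)) ⟩
    A + suc u * n    ≤⟨ +-monoʳ-≤ A (*-monoˡ-≤ n u<a) ⟩
    A + a * n        ≤⟨ m≤m+n _ b ⟩
    A + a * n + b    ∎
    where open ≤-Reasoning

  cell-injective : ∀ {u v a b} → v < n → b < n → cell u v ≡ cell a b → u ≡ a × v ≡ b
  cell-injective {u} {v} {a} {b} v<n b<n e with <-cmp u a
  ... | tri< u<a _ _ = ⊥-elim (<-irrefl e (cell-< {u} {v} {a} {b} v<n u<a))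
  ... | tri> _ _ a<u = ⊥-elim (<-irrefl (sym e) (cell-< {a} {b} {u} {v} b<n a<u))
  ... | tri≈ _ refl _ = refl , +-cancelˡ-≡ (A + u * n) v b e

  record Filled (μ : Addr → ℕ) : Set where
    constructor filled
    field
      below : ∀ a → a < A → μ a ≡ μ₀ a
      sound : ∀ u v → u < n → v < n → μ (cell u v) ≡ 0 ⊎ (μ (cell u v) ≡ 1 × Good u v)

  filled-mark : ∀ {μ a b} → a < n → b < n → Good a b → Filled μ → Filled (μ [ cell a b ↦ 1 ])
  filled-mark {μ} {a} {b} a<n b<n g (filled bl so) = filled
    (λ c c<A → trans
      (update-other μ 1 λ e → <⇒≱ c<A
        (≤-trans (≤-trans (m≤m+n A (a * n)) (m≤m+n _ b)) (≤-reflexive (sym e))))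
      (bl c c<A))
    sound′
    where
    sound′ : ∀ u v → u < n → v < n → (μ [ cell a b ↦ 1 ]) (cell u v) ≡ 0 ⊎ ((μ [ cell a b ↦ 1 ]) (cell u v) ≡ 1 × Good u v)
    sound′ u v u<n v<n with cell u v ≟ cell a b
    ... | yes e with refl , refl ← cell-injective {u} {v} {a} {b} v<n b<n e =
      inj₂ (update-same μ (cell a b) 1 , g)
    ... | no ne rewrite update-other μ 1 ne = so u v u<n v<n

  mark-keeps : ∀ (μ : Addr → ℕ) i c → μ c ≡ 1 → (μ [ i ↦ 1 ]) c ≡ 1
  mark-keeps μ i c e with c ≟ i
  ... | yes refl = update-same μ c 1
  ... | no ne    = trans (update-other μ 1 ne) e

  marked : ∀ {μ : Addr → ℕ} {ρ o p q a b} → Filled μ → a < n → ρ ≡ T → o ≡ 1 → p ≡ a → q ≡ b →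
           μ [ μ (ρ + p) + q ↦ o ] ≡ μ [ cell a b ↦ 1 ]
  marked {μ} F a<n refl refl refl refl =
    cong (λ i → μ [ i + _ ↦ 1 ]) (trans (Filled.below F _ (<-≤-trans (+-monoʳ-< T a<n) T+n≤A)) (μ₀-table _ a<n))

  module _ (σ : State) (e₁ : reg σ rOne ≡ 1) (e₀ : reg σ ans ≡ 0)
           (eV : reg σ #V ≡ n) (eT : reg σ aT ≡ T) (F : Filled (mem σ)) where

    fillDiagonal-runs : (∀ u → u < n → Good u u) →
      Runs fillDiagonal σ (1 + suc n * 6) λ τ → Agree 20 σ τ × Filled (mem τ) ×
        (∀ c → mem σ c ≡ 1 → mem τ c ≡ 1) × (∀ u → u < n → mem τ (cell u u) ≡ 1)
    fillDiagonal-runs good =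
      block {Q = λ τ → Inv n τ × reg τ ctr ≡ n}
        ((agree-refl 20 σ , F , (λ _ → id) , ≤-refl , (λ u n≤u u<n → ⊥-elim (<⇒≱ u<n n≤u))) , plus-zero eV e₀)
      then λ τ (inv , e) → weaken (λ { τ (ag , F , ke , _ , di) → ag , F , ke , λ u → di u z≤n })
        (countdown Inv step n τ e inv)
      where
      Inv : ℕ → State → Set
      Inv i τ = Agree 20 σ τ × Filled (mem τ) × (∀ c → mem σ c ≡ 1 → mem τ c ≡ 1) × i ≤ n ×
        (∀ u → i ≤ u → u < n → mem τ (cell u u) ≡ 1)
      step : ∀ i τ → reg τ ctr ≡ suc i → Inv (suc i) τ →
             Runs diagonalStep τ 5 λ τ → reg τ ctr ≡ i × Inv i τ
      step i τ₀@(⟪ ρ , μ ⟫) e (ag , F , ke , i<n , di) =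
        block (c≡ , ag , subst Filled (sym m≡) (filled-mark i<n i<n (good i i<n) F)
              , (λ c m → trans (cong (λ μ → μ c) m≡) (mark-keeps μ (cell i i) c (ke c m)))
              , <⇒≤ i<n
              , (λ u i≤u u<n → trans (cong (λ μ → μ (cell u u)) m≡) (new u (u ≟ i) i≤u u<n)))
        where
        same = kept 20 σ τ₀ ag
        c≡ = pred-ctr e (trans (same rOne) e₁)
        m≡ = marked F i<n (trans (same aT) eT) (trans (same rOne) e₁) c≡ c≡
        new : ∀ u → Dec (u ≡ i) → i ≤ u → u < n → (μ [ cell i i ↦ 1 ]) (cell u u) ≡ 1
        new u (yes refl) _ _ = update-same μ (cell u u) 1
        new u (no ne) i≤u u<n = mark-keeps μ (cell i i) (cell u u) (di u (≤∧≢⇒< i≤u (ne ∘ sym)) u<n)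

    fillEdges-runs : let m = reg σ #E ; E = reg σ aE in
      E + m + m ≤ A →
      (∀ j → j < m → let a = μ₀ (E + j + j) ; b = μ₀ (E + j + j + 1) in
         a < n × b < n × Good a b × Good b a) →
      Runs fillEdges σ (1 + suc m * 15) λ τ → Agree 20 σ τ × Filled (mem τ) ×
        (∀ j → j < m → let a = μ₀ (E + j + j) ; b = μ₀ (E + j + j + 1) in
           mem τ (cell a b) ≡ 1 × mem τ (cell b a) ≡ 1)
    fillEdges-runs E+2m≤A edge =
      block {Q = λ τ → Inv m τ × reg τ ctr ≡ m}
        ((agree-refl 20 σ , F , ≤-refl , (λ u n≤u u<n → ⊥-elim (<⇒≱ u<n n≤u))) , plus-zero refl e₀)
      then λ τ (inv , e) → weaken (λ { τ (ag , F , _ , di) → ag , F , λ u → di u z≤n })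
        (countdown Inv step m τ e inv)
      where
      m = reg σ #E
      E = reg σ aE
      fst snd : ℕ → ℕ
      fst j = μ₀ (E + j + j)
      snd j = μ₀ (E + j + j + 1)
      Inv : ℕ → State → Set
      Inv i τ = Agree 20 σ τ × Filled (mem τ) × i ≤ m ×
        (∀ j → i ≤ j → j < m → mem τ (cell (fst j) (snd j)) ≡ 1 × mem τ (cell (snd j) (fst j)) ≡ 1)
      step : ∀ i τ → reg τ ctr ≡ suc i → Inv (suc i) τ →
             Runs edgeStep τ 14 λ τ → reg τ ctr ≡ i × Inv i τ
      step i τ₀@(⟪ ρ , μ ⟫) e (ag , F , i<m , di) with edge i i<m
      ... | a<n , b<n , gab , gba =
        block (c≡ , ag , subst Filled (sym m≡₂) F₂ , <⇒≤ i<m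
              , λ j i≤j j<m → subst (λ μ → μ (cell (fst j) (snd j)) ≡ 1 × μ (cell (snd j) (fst j)) ≡ 1)
                                (sym m≡₂) (new j (j ≟ i) i≤j j<m))
        where
        same = kept 20 σ τ₀ ag
        one = trans (same rOne) e₁
        c≡ = pred-ctr e one
        addr : ρ aE + (ρ ctr ∸ ρ rOne) + (ρ ctr ∸ ρ rOne) ≡ E + i + i
        addr = cong₂ _+_ (cong₂ _+_ (same aE) c≡) c≡
        E+2i<A : E + i + i + 1 < A
        E+2i<A = begin-strict
          E + i + i + 1       <⟨ ≤-refl ⟩
          suc (E + i + i + 1) ≡⟨ arith E i ⟩
          E + suc i + suc i   ≤⟨ +-mono-≤ (+-monoʳ-≤ E i<m) i<m ⟩
          E + m + m           ≤⟨ E+2m≤A ⟩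
          A                   ∎
          where
          open ≤-Reasoning
          arith : ∀ E i → suc (E + i + i + 1) ≡ E + suc i + suc i
          arith = solve-∀
        end₁ end₂ : ℕ
        end₁ = μ (ρ aE + (ρ ctr ∸ ρ rOne) + (ρ ctr ∸ ρ rOne))
        end₂ = μ (ρ aE + (ρ ctr ∸ ρ rOne) + (ρ ctr ∸ ρ rOne) + ρ rOne)
        fst≡ : end₁ ≡ fst i
        fst≡ = trans (cong μ addr) (Filled.below F _ (≤-<-trans (m≤m+n _ 1) E+2i<A))
        snd≡ : end₂ ≡ snd i
        snd≡ = trans (cong μ (cong₂ _+_ addr one)) (Filled.below F _ E+2i<A)
        μ₁ μ₂ : Addr → ℕ
        μ₁ = μ [ cell (fst i) (snd i) ↦ 1 ]
        μ₂ = μ₁ [ cell (snd i) (fst i) ↦ 1 ]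
        F₁ : Filled μ₁
        F₁ = filled-mark a<n b<n gab F
        F₂ : Filled μ₂
        F₂ = filled-mark b<n a<n gba F₁
        m≡₁ = marked F a<n (trans (same aT) eT) one fst≡ snd≡
        m≡₂ = trans (cong (λ μ → μ [ μ (ρ aT + end₂) + end₁ ↦ ρ rOne ]) m≡₁)
                    (marked F₁ b<n (trans (same aT) eT) one snd≡ fst≡)
        new : ∀ j → Dec (j ≡ i) → i ≤ j → j < m → μ₂ (cell (fst j) (snd j)) ≡ 1 × μ₂ (cell (snd j) (fst j)) ≡ 1
        c₁ c₂ : ℕ → Addr
        c₁ j = cell (fst j) (snd j)
        c₂ j = cell (snd j) (fst j)
        new j (yes refl) _ _ =
          mark-keeps μ₁ (c₂ j) (c₁ j) (update-same μ (c₁ j) 1) , update-same μ₁ (c₂ j) 1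
        new j (no ne) i≤j j<m with p , q ← di j (≤∧≢⇒< i≤j (ne ∘ sym)) j<m =
          mark-keeps μ₁ (c₂ i) (c₁ j) (mark-keeps μ (c₁ i) (c₁ j) p)
          , mark-keeps μ₁ (c₂ i) (c₂ j) (mark-keeps μ (c₁ i) (c₂ j) q)

sumBelow maxBelow : (ℕ → ℕ) → ℕ → ℕ
sumBelow f zero    = 0
sumBelow f (suc i) = f i + sumBelow f i
maxBelow f zero    = 0
maxBelow f (suc i) = f i ⊔ maxBelow f i

-- The right-hand side is how `degreeStep` updates its maximum.
m⊔n≡m+[n∸m] : ∀ m n → m ⊔ n ≡ m + (n ∸ m)
m⊔n≡m+[n∸m] m n with ≤-total m n
... | inj₁ m≤n rewrite m≤n⇒m⊔n≡n m≤n = sym (m+[n∸m]≡n m≤n)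
... | inj₂ n≤m rewrite m≥n⇒m⊔n≡m n≤m | m≤n⇒m∸n≡0 n≤m = sym (+-identityʳ m)

largestDegree-runs : ∀ σ → reg σ rOne ≡ 1 → reg σ ans ≡ 0 →
  let n = reg σ #V in
  Runs largestDegree σ (2 + suc n * (suc n * 13)) λ τ →
    Agree 14 σ τ × mem τ ≡ mem σ ×
    reg τ rMul ≡ maxBelow (λ u → sumBelow (λ v → mem σ (mem σ (reg σ aT + u) + v)) n) n
largestDegree-runs σ e₁ e₀ =
  within (+-monoʳ-≤ 2 (*-monoʳ-≤ (suc n) (absorb 1 n 12)))
  (block {Q = λ τ → Inv n τ × reg τ ctr ≡ n}
    ((agree-refl 14 σ , refl , refl) , plus-zero refl e₀)
  then λ τ (inv , e) → weaken (λ { τ (ag , m , mx) → ag , m , trans (sym (⊔-identityʳ _)) mx })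
    (countdown Inv step n τ e inv))
  where
  n = reg σ #V
  μ = mem σ
  f : ℕ → ℕ → ℕ
  f u v = μ (μ (reg σ aT + u) + v)
  g : ℕ → ℕ
  g u = sumBelow (f u) n
  Inv : ℕ → State → Set
  Inv i τ = Agree 14 σ τ × mem τ ≡ μ × reg τ rMul ⊔ maxBelow g i ≡ maxBelow g n
  step : ∀ i τ → reg τ ctr ≡ suc i → Inv (suc i) τ →
         Runs degreeStep τ (suc n * 12) λ τ → reg τ ctr ≡ i × Inv i τ
  step i τ₀@(⟪ ρ , _ ⟫) e (ag , refl , mx) =
    within (≤-trans (≤-reflexive (arith (suc n * 5))) (absorb 7 n 5))
    (block {Q = λ τ → Inner n τ × reg τ ctr′ ≡ n}
      ((pred-ctr e one , ag , refl , refl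
       , cong μ (cong₂ _+_ (same aT) (pred-ctr e one)) , refl) , plus-zero (same #V) (trans (same ans) e₀))
    then λ τ (inv , e) → countdown Inner inner n τ e inv
    then λ { τ (c≡ , ag , m , mul , _ , s) → block
      (c≡ , ag , m , trans (cong (_⊔ maxBelow g i)
                         (trans (sym (m⊔n≡m+[n∸m] (reg τ rMul) (reg τ ok)))
                                (cong₂ _⊔_ mul (trans (sym (+-identityʳ _)) s))))
                       (trans (⊔-assoc (ρ rMul) (g i) (maxBelow g i)) mx)) })
    where
    same = kept 14 σ τ₀ ag
    one = trans (same rOne) e₁
    arith : ∀ a → 5 + (a + 2) ≡ 7 + a
    arith = solve-∀
    Inner : ℕ → State → Set
    Inner l τ = reg τ ctr ≡ i × Agree 14 σ τ × mem τ ≡ μ × reg τ rMul ≡ ρ rMul ×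
      reg τ row ≡ μ (reg σ aT + i) × reg τ ok + sumBelow (f i) l ≡ g i
    inner : ∀ l τ → reg τ ctr′ ≡ suc l → Inner (suc l) τ →
            Runs sumStep τ 4 λ τ → reg τ ctr′ ≡ l × Inner l τ
    inner l τ₁@(⟪ ρ₁ , _ ⟫) e′ (c≡ , ag , refl , mul , r≡ , s) = block
      (cd , c≡ , ag , refl , mul , r≡
      , trans (cong (λ q → ρ₁ ok + q + sumBelow (f i) l) (cong μ (cong₂ _+_ r≡ cd)))
          (trans (+-assoc (ρ₁ ok) (f i l) _) s))
      where
      cd = pred-ctr e′ (trans (kept 14 σ τ₁ ag rOne) e₁)

-- Locating sets

count : ∀ {n} → (Fin n → Bool) → ℕ
count {zero}  f = 0
count {suc n} f = bit (f zero) + count (f ∘ suc)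

insert : ∀ {n} → Fin n → (Fin n → Bool) → Fin n → Bool
insert x f v = does (v Fin.≟ x) ∨ f v

bit-mono : ∀ {a b} → (a ≡ true → b ≡ true) → bit a ≤ bit b
bit-mono {false} _ = z≤n
bit-mono {true} {b} h rewrite h refl = ≤-refl

count-mono : ∀ {n} {f g : Fin n → Bool} → (∀ i → f i ≡ true → g i ≡ true) → count f ≤ count g
count-mono {zero}  h = z≤n
count-mono {suc n} h = +-mono-≤ (bit-mono (h zero)) (count-mono (h ∘ suc))

count-strict : ∀ {n} {f g : Fin n → Bool} → (∀ i → f i ≡ true → g i ≡ true) →
               ∀ x → f x ≡ false → g x ≡ true → count f < count g
count-strict {f = f} {g} h zero fx gx rewrite fx | gx = s≤s (count-mono (h ∘ suc))
count-strict {f = f} {g} h (suc x) fx gx =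
  ≤-trans (≤-reflexive (sym (+-suc (bit (f zero)) _)))
          (+-mono-≤ (bit-mono (h zero)) (count-strict (h ∘ suc) x fx gx))

count-insert : ∀ {n} x {f : Fin n → Bool} → f x ≡ false → count (insert x f) ≡ suc (count f)
count-insert zero    fx rewrite fx = refl
count-insert (suc x) {f} fx =
  trans (cong (_+_ (bit (f zero))) (count-insert x {f ∘ suc} fx)) (+-suc (bit (f zero)) _)

insert-self : ∀ {n} x (f : Fin n → Bool) → insert x f x ≡ true
insert-self x f rewrite dec-true (x Fin.≟ x) refl = refl

insert-other : ∀ {n} x (f : Fin n → Bool) {v} → v ≢ x → insert x f v ≡ f v
insert-other x f {v} v≢x rewrite dec-false (v Fin.≟ x) v≢x = refl

insert-keeps : ∀ {n} x (f : Fin n → Bool) v → f v ≡ true → insert x f v ≡ true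
insert-keeps x f v fv rewrite fv = ∨-zeroʳ _

count-insert-≤ : ∀ {n} x (f : Fin n → Bool) → count (insert x f) ≤ suc (count f)
count-insert-≤ x f with f x in fx
... | false = ≤-reflexive (count-insert x fx)
... | true  = m≤n⇒m≤1+n (count-mono λ v → already v (v Fin.≟ x))
  where
  already : ∀ v → Dec (v ≡ x) → insert x f v ≡ true → f v ≡ true
  already v (yes refl) _ = fx
  already v (no v≢x)   e = trans (sym (insert-other x f v≢x)) e

length-filter-tabulate : ∀ {n} {A : Set} {P : A → Set} (P? : ∀ x → Dec (P x)) (g : Fin n → A) →
  length (filter P? (tabulate g)) ≡ count (λ i → does (P? (g i)))
length-filter-tabulate {zero}  P? g = refl
length-filter-tabulate {suc n} P? g with does (P? (g zero))
... | true  = cong suc (length-filter-tabulate P? (g ∘ suc))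
... | false = length-filter-tabulate P? (g ∘ suc)

∣p∣≡count : ∀ {n} (S : Subset n) → ∣ S ∣ ≡ count (lookup S)
∣p∣≡count Vec.[]            = refl
∣p∣≡count (true  Vec.∷ S) = cong suc (∣p∣≡count S)
∣p∣≡count (false Vec.∷ S) = ∣p∣≡count S

count-cong : ∀ {n} {f g : Fin n → Bool} → (∀ i → f i ≡ g i) → count f ≡ count g
count-cong {zero}  h = refl
count-cong {suc n} h = cong₂ _+_ (cong bit (h zero)) (count-cong (h ∘ suc))

member : ∀ {n} → List (Fin n) → Fin n → Bool
member []      v = false
member (x ∷ L) v = insert x (member L) v

member-∈ : ∀ {n} {L : List (Fin n)} {v} → v ∈ L → member L v ≡ true
member-∈ {L = x ∷ L} (here refl) = insert-self x (member L)
member-∈ {L = x ∷ L} {v} (there p) = insert-keeps x (member L) v (member-∈ p)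

count-member : ∀ {n} (L : List (Fin n)) → count (member L) ≤ length L
count-member {n} [] = ≤-reflexive (none n)
  where
  none : ∀ n → count {n} (λ _ → false) ≡ 0
  none zero    = refl
  none (suc n) = none n
count-member (x ∷ L) = ≤-trans (count-insert-≤ x (member L)) (s≤s (count-member L))

lookup-ext : ∀ {n} {xs ys : Subset n} → (∀ i → lookup xs i ≡ lookup ys i) → xs ≡ ys
lookup-ext {xs = xs} {ys} h =
  trans (sym (Vec.tabulate∘lookup xs)) (trans (Vec.tabulate-cong h) (Vec.tabulate∘lookup ys))

does-true : ∀ {P : Set} (d : Dec P) → does d ≡ true → P
does-true (yes p) _ = p

bool-contra : ∀ {b} → b ≡ true → b ≡ false → ∀ {A : Set} → A
bool-contra refl ()

module Neighbourhoods {n : ℕ} (G : Graph n) where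
  open Graph G

  nb : Fin n → Fin n → Bool
  nb x v = does ((v Fin.≟ x) ⊎-dec (x ~? v))

  adjacent : Fin n → Fin n → Bool
  adjacent x v = does (x ~? v)

  nb-self : ∀ x → nb x x ≡ true
  nb-self x = insert-self x (adjacent x)

  nb-adjacent : ∀ {x v} → x ~ v → nb x v ≡ true
  nb-adjacent {x} {v} p = insert-keeps x (adjacent x) v (dec-true (x ~? v) p)

  nb-far : ∀ {x v} → v ≢ x → ¬ x ~ v → nb x v ≡ false
  nb-far {x} {v} v≢x ¬p = trans (insert-other x (adjacent x) v≢x) (dec-false (x ~? v) ¬p)

  nb-cases : ∀ {x v} → nb x v ≡ true → v ≡ x ⊎ x ~ v
  nb-cases {x} {v} = does-true ((v Fin.≟ x) ⊎-dec (x ~? v))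

  degree≡count : ∀ x → degree x ≡ count (adjacent x)
  degree≡count x = length-filter-tabulate (x ~?_) id

  count-nb : ∀ x → count (nb x) ≡ suc (degree x)
  count-nb x = trans (count-insert x (dec-false (x ~? x) (~-irr refl))) (cong suc (sym (degree≡count x)))

  nb-sound-≢ : ∀ {x y} → N[ x ] ≢ N[ y ] → ∃[ v ] nb x v ≢ nb y v
  nb-sound-≢ {x} {y} ne = ¬∀⟶∃¬ n _ (λ v → nb x v Bool.≟ nb y v) λ same →
    ne (Vec.tabulate-cong same)

  foldr-⊔ : ∀ {m} (d : Fin n → ℕ) (g : Fin m → Fin n) i → d (g i) ≤ foldr _⊔_ 0 (map d (tabulate g))
  foldr-⊔ d g zero    = m≤m⊔n _ _
  foldr-⊔ d g (suc i) = ≤-trans (foldr-⊔ d (g ∘ suc) i) (m≤n⊔m _ _)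

  degree≤maxDegree : ∀ x → degree x ≤ maxDegree
  degree≤maxDegree = foldr-⊔ degree id

  Locatable : Fin n → ℕ → Set
  Locatable x m = ∃[ L ] length L ≤ m × ∀ y → y ≢ x → ∃[ v ] v ∈ L × nb x v ≢ nb y v

  split : ∀ {x y v} → nb x v ≡ true → nb y v ≡ false → nb x v ≢ nb y v
  split p q e = bool-contra (trans (sym e) p) q

  split′ : ∀ {x y v} → nb x v ≡ false → nb y v ≡ true → nb x v ≢ nb y v
  split′ p q e = bool-contra (trans e q) p

  by-itself : ∀ {x y} → y ≢ x → ¬ x ~ y → nb x x ≢ nb y x
  by-itself {x} {y} y≢x ¬p = split {x} {y} (nb-self x) (nb-far (y≢x ∘ sym) (¬p ∘ ~-sym))

  module _ (twinFree : TwinFree) where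

    separator : ∀ x y → x ≢ y → ∃[ v ] nb x v ≢ nb y v
    separator x y x≢y = nb-sound-≢ (twinFree x y x≢y)

    -- A non-neighbour of x is told apart by x itself. Two neighbours of x are never adjacent, so a
    -- neighbour other than u is not dominated by u, and u in turn is told apart by a second
    -- neighbour w. If u is the only neighbour, it is the only vertex left to tell apart.
    locate-triangleFree : TriangleFree → ∀ x → Locatable x 3
    locate-triangleFree tf x with any? (x ~?_)
    ... | no none = x ∷ [] , s≤s z≤n , λ y y≢x → x , here refl , by-itself y≢x λ p → none (y , p)
    ... | yes (u , x~u) with any? (λ w → (x ~? w) ×-dec ¬? (w Fin.≟ u))
    ...   | yes (w , x~w , w≢u) = x ∷ u ∷ w ∷ [] , ≤-refl , sep
      where
      sep : ∀ y → y ≢ x → ∃[ v ] v ∈ x ∷ u ∷ w ∷ [] × nb x v ≢ nb y v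
      sep y y≢x with x ~? y | y Fin.≟ u
      ... | no ¬p | _ = x , here refl , by-itself y≢x ¬p
      ... | yes _ | yes refl = w , there (there (here refl)) ,
        split {x} {y} (nb-adjacent x~w) (nb-far w≢u λ u~w → tf x y w (x~u , u~w , ~-sym x~w))
      ... | yes x~y | no y≢u = u , there (here refl) ,
        split {x} {y} (nb-adjacent x~u) (nb-far (y≢u ∘ sym) λ y~u → tf x y u (x~y , y~u , ~-sym x~u))
    ...   | no only with separator x u (λ e → ~-irr e x~u)
    ...     | z , ne = x ∷ z ∷ [] , s≤s (s≤s z≤n) , sep
      where
      sep : ∀ y → y ≢ x → ∃[ v ] v ∈ x ∷ z ∷ [] × nb x v ≢ nb y v
      sep y y≢x with x ~? y | y Fin.≟ u
      ... | no ¬p | _        = x , here refl , by-itself y≢x ¬p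
      ... | yes _ | yes refl = z , there (here refl) , ne
      ... | yes p | no y≢u   = ⊥-elim (only (y , p , y≢u))

    separatorOf : Fin n → Fin n → Fin n
    separatorOf x y with x Fin.≟ y
    -- An arbitrary value on the diagonal, making the function total so that it can be mapped over
    -- the neighbours.
    ... | yes _  = x
    ... | no x≢y = proj₁ (separator x y x≢y)

    separatorOf-≢ : ∀ {x y} → x ≢ y → nb x (separatorOf x y) ≢ nb y (separatorOf x y)
    separatorOf-≢ {x} {y} x≢y with x Fin.≟ y
    ... | yes e = ⊥-elim (x≢y e)
    ... | no ne = proj₂ (separator x y ne)

    neighbours : Fin n → List (Fin n)
    neighbours x = filter (x ~?_) (allFin n)

    ∈-neighbours : ∀ {x v} → x ~ v → v ∈ neighbours x
    ∈-neighbours {x} {v} p = ∈-filter⁺ (x ~?_) (∈-allFin v) p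

    -- By cardinality the two closed neighbourhoods would coincide.
    not-dominated : ∀ {x b} → b ≢ x → degree x ≡ maxDegree → ¬ (∀ v → nb x v ≡ true → nb b v ≡ true)
    not-dominated {x} {b} b≢x dx sub with separator x b (b≢x ∘ sym)
    ... | v , ne = <⇒≱ fewer (begin
        count (nb b)      ≡⟨ count-nb b ⟩
        suc (degree b)    ≤⟨ s≤s (degree≤maxDegree b) ⟩
        suc maxDegree     ≡⟨ cong suc dx ⟨
        suc (degree x)    ≡⟨ count-nb x ⟨
        count (nb x)      ∎)
      where
      open ≤-Reasoning
      fewer : count (nb x) < count (nb b)
      fewer with nb x v in e | nb b v in e′
      ... | true  | true  = ⊥-elim (ne refl)
      ... | false | false = ⊥-elim (ne refl)
      ... | false | true  = count-strict sub v e e′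
      ... | true  | false = bool-contra (sub v e) e′

    -- In the exceptional case every neighbour y of x lies in N[b], so b lies in N[y] but not in
    -- N[x]; non-neighbours are told apart by x. The pair of x and b has to fit into Δ elements,
    -- whence the hypothesis 2 ≤ Δ.
    locate-maxDegree : 2 ≤ maxDegree → ∀ x → Locatable x maxDegree
    locate-maxDegree 2≤Δ x with degree x <? maxDegree
    ... | yes d<Δ = x ∷ map (separatorOf x) (neighbours x)
                  , ≤-trans (≤-reflexive (cong suc (length-map (separatorOf x) (neighbours x)))) d<Δ , sep
      where
      sep : ∀ y → y ≢ x → ∃[ v ] v ∈ x ∷ map (separatorOf x) (neighbours x) × nb x v ≢ nb y v
      sep y y≢x with x ~? y
      ... | no ¬p = x , here refl , by-itself y≢x ¬p
      ... | yes p = separatorOf x y , there (∈-map⁺ (separatorOf x) (∈-neighbours p)) , separatorOf-≢ (y≢x ∘ sym)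
    ... | no d≮Δ with any? (λ b → ¬? (b Fin.≟ x) ×-dec all? (λ v → (x ~? v) →-dec (nb b v Bool.≟ true)))
    ...   | no none = neighbours x , degree≤maxDegree x , sep
      where
      sep : ∀ y → y ≢ x → ∃[ v ] v ∈ neighbours x × nb x v ≢ nb y v
      sep y y≢x with any? (λ v → (x ~? v) ×-dec (nb y v Bool.≟ false))
      ... | yes (v , p , e) = v , ∈-neighbours p , split {x} {y} (nb-adjacent p) e
      ... | no no-v = ⊥-elim (none (y , y≢x , λ v p → ¬-not λ e → no-v (v , p , e)))
    ...   | yes (b , b≢x , sub) = x ∷ b ∷ [] , 2≤Δ , sep
      where
      dx : degree x ≡ maxDegree
      dx = ≤-antisym (degree≤maxDegree x) (≮⇒≥ d≮Δ)
      ¬x~b : ¬ x ~ b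
      ¬x~b p = not-dominated b≢x dx λ v e → case nb-cases {x} {v} e of λ where
        (inj₁ refl) → nb-adjacent (~-sym p)
        (inj₂ q)    → sub v q
      sep : ∀ y → y ≢ x → ∃[ v ] v ∈ x ∷ b ∷ [] × nb x v ≢ nb y v
      sep y y≢x with x ~? y
      ... | no ¬p = x , here refl , by-itself y≢x ¬p
      ... | yes p = b , there (here refl) , split′ {x} {y} (nb-far b≢x ¬x~b) (meets (nb-cases {b} {y} (sub y p)))
        where
        meets : y ≡ b ⊎ b ~ y → nb y b ≡ true
        meets (inj₁ refl) = nb-self y
        meets (inj₂ q)    = nb-adjacent (~-sym q)

    2≤degree : ∀ {x u w} → x ~ u → x ~ w → u ≢ w → 2 ≤ degree x
    2≤degree {x} {u} {w} p q u≢w = begin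
      2                                           ≤⟨ s≤s (≤-trans (s≤s z≤n) (≤-reflexive (sym (count-insert u {λ _ → false} refl)))) ⟩
      suc (count (insert u (λ _ → false)))        ≡⟨ count-insert w {insert u λ _ → false} (insert-other u (λ _ → false) (u≢w ∘ sym)) ⟨
      count (insert w (insert u λ _ → false))     ≤⟨ count-mono both ⟩
      count (adjacent x)                          ≡⟨ degree≡count x ⟨
      degree x                                    ∎
      where
      open ≤-Reasoning
      both : ∀ v → insert w (insert u λ _ → false) v ≡ true → adjacent x v ≡ true
      both v e with v Fin.≟ w | v Fin.≟ u
      ... | yes refl | _        = dec-true (x ~? v) q
      ... | no _     | yes refl = dec-true (x ~? v) p
      both v () | no _ | no _

    -- The ends of an edge are not twins, so some w lies in exactly one of their closed
    -- neighbourhoods; that end then has both w and the other end as neighbours.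
    2≤maxDegree : ∀ {u v} → u ~ v → 2 ≤ maxDegree
    2≤maxDegree {u} {v} p with separator u v (λ e → ~-irr e p)
    ... | w , ne with nb u w in e | nb v w in e′
    ...   | true  | true  = ⊥-elim (ne refl)
    ...   | false | false = ⊥-elim (ne refl)
    ...   | true  | false with nb-cases {u} {w} e
    ...     | inj₁ refl = bool-contra (nb-adjacent (~-sym p)) e′
    ...     | inj₂ q    = ≤-trans (2≤degree p q λ { refl → bool-contra (nb-self v) e′ }) (degree≤maxDegree u)
    2≤maxDegree {u} {v} p | w , ne | false | true with nb-cases {v} {w} e′
    ...     | inj₁ refl = bool-contra (nb-adjacent p) e
    ...     | inj₂ q    = ≤-trans (2≤degree (~-sym p) q λ { refl → bool-contra (nb-self u) e }) (degree≤maxDegree v)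

-- Red-blue separating sets

length-concatMap-≤ : ∀ {A B : Set} (f : A → List B) m → (∀ x → length (f x) ≤ m) →
                     ∀ xs → length (concatMap f xs) ≤ m * length xs
length-concatMap-≤ f m h []       = z≤n
length-concatMap-≤ f m h (x ∷ xs) = begin
  length (f x ++ concatMap f xs)           ≡⟨ length-++ (f x) ⟩
  length (f x) + length (concatMap f xs)   ≤⟨ +-mono-≤ (h x) (length-concatMap-≤ f m h xs) ⟩
  m + m * length xs                        ≡⟨ *-suc m (length xs) ⟨
  m * suc (length xs)                      ∎
  where open ≤-Reasoning

module Separation {n : ℕ} (G : Graph n) (c : Colouring n) where
  open Graph G
  open Neighbourhoods G

  R B : List (Fin n)
  R = colourClass c red
  B = colourClass c blue

  ∈-class : ∀ {a v} → c v ≡ a → v ∈ colourClass c a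
  ∈-class {a} {v} e = ∈-filter⁺ (λ v → c v ≟ᶜ a) (∈-allFin v) e

  ∈-class⁻ : ∀ {a v} → v ∈ colourClass c a → c v ≡ a
  ∈-class⁻ {a} p = proj₂ (∈-filter⁻ (λ v → c v ≟ᶜ a) {xs = allFin n} p)

  lookup-∩ : ∀ S x v → lookup (N[ x ] ∩ S) v ≡ nb x v ∧ lookup S v
  lookup-∩ S x v = trans (Vec.lookup-zipWith _∧_ v N[ x ] S)
                         (cong (_∧ lookup S v) (Vec.lookup∘tabulate (nb x) v))

  Splits : Subset n → Set
  Splits S = ∀ r b → c r ≡ red → c b ≡ blue → ∃[ v ] lookup S v ≡ true × nb r v ≢ nb b v

  splits⇒separating : ∀ {S} → Splits S → Separating G c S
  splits⇒separating {S} sp r b cr cb e with v , v∈S , ne ← sp r b cr cb =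
    ne (trans (sym (restrict r)) (trans (cong (λ T → lookup T v) e) (restrict b)))
    where
    restrict : ∀ x → lookup (N[ x ] ∩ S) v ≡ nb x v
    restrict x = trans (lookup-∩ S x v) (trans (cong (nb x v ∧_) v∈S) (∧-identityʳ _))

  -- The witness comes from an exhaustive search over v: if it failed, the two restricted
  -- neighbourhoods would coincide.
  separating⇒splits : ∀ {S} → Separating G c S → Splits S
  separating⇒splits {S} sep r b cr cb
    with any? (λ v → (lookup S v Bool.≟ true) ×-dec ¬? (nb r v Bool.≟ nb b v))
  ... | yes p   = p
  ... | no none = ⊥-elim (sep r b cr cb (lookup-ext λ v →
      trans (lookup-∩ S r v) (trans (same v (lookup S v) refl) (sym (lookup-∩ S b v)))))
    where
    same : ∀ v s → lookup S v ≡ s → nb r v ∧ s ≡ nb b v ∧ s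
    same v false _ = trans (∧-zeroʳ _) (sym (∧-zeroʳ _))
    same v true  e = cong (_∧ true)
      (decidable-stable (nb r v Bool.≟ nb b v) λ ne → none (v , e , ne))

  separating? : ∀ S → Dec (Separating G c S)
  separating? S = all? λ r → all? λ b → (c r ≟ᶜ red) →-dec ((c b ≟ᶜ blue) →-dec
    ¬? (Vec.≡-dec Bool._≟_ (N[ r ] ∩ S) (N[ b ] ∩ S)))

  separating-list : ∀ L → (∀ r b → c r ≡ red → c b ≡ blue → ∃[ v ] v ∈ L × nb r v ≢ nb b v) →
                    ∃[ S ] Separating G c S × ∣ S ∣ ≤ length L
  separating-list L h = S , splits⇒separating (λ r b cr cb → case h r b cr cb of λ where
      (v , v∈L , ne) → v , trans (Vec.lookup∘tabulate (member L) v) (member-∈ v∈L) , ne)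
    , ≤-trans (≤-reflexive (trans (∣p∣≡count S) (count-cong (Vec.lookup∘tabulate (member L)))))
              (count-member L)
    where
    S : Subset n
    S = Vec.tabulate (member L)

  separating-≤ : ∀ {m} → (∀ x → Locatable x m) →
                 ∃[ S ] Separating G c S × ∣ S ∣ ≤ m * (length R ⊓ length B)
  separating-≤ {m} loc with ≤-total (length R) (length B)
  ... | inj₁ R≤B rewrite m≤n⇒m⊓n≡m R≤B =
      case separating-list (concatMap located R) (λ r b cr cb →
        case proj₂ (proj₂ (loc r)) b (λ { refl → red≢blue (trans (sym cr) cb) }) of λ where
          (v , v∈L , ne) → v , ∈-concatMap⁺ located (lose (∈-class cr) v∈L) , ne)
      of λ where (S , sep , le) → S , sep , ≤-trans le (length-concatMap-≤ located m (proj₁ ∘ proj₂ ∘ loc) R)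
    where
    located = proj₁ ∘ loc
    red≢blue : red ≢ blue
    red≢blue ()
  ... | inj₂ B≤R rewrite m≥n⇒m⊓n≡n B≤R =
      case separating-list (concatMap located B) (λ r b cr cb →
        case proj₂ (proj₂ (loc b)) r (λ { refl → red≢blue (trans (sym cr) cb) }) of λ where
          (v , v∈L , ne) → v , ∈-concatMap⁺ located (lose (∈-class cb) v∈L) , ne ∘ sym)
      of λ where (S , sep , le) → S , sep , ≤-trans le (length-concatMap-≤ located m (proj₁ ∘ proj₂ ∘ loc) B)
    where
    located = proj₁ ∘ loc
    red≢blue : red ≢ blue
    red≢blue ()

  SeparableBy : ℕ → Set
  SeparableBy k = ∃[ S ] Separating G c S × ∣ S ∣ ≤ k

  -- A yes-instance is defined through a minimum. Lowering k as long as some subset still fits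
  -- attains it constructively, so only `SeparableBy` has to be decided.
  smallest : ∀ k → SeparableBy k → ∃[ s ] SepRB G c s × s ≤ k
  smallest zero    (S , sep , le) = ∣ S ∣ , ((S , sep , refl) , λ S′ _ → ≤-trans le z≤n) , le
  smallest (suc k) (S , sep , le) with anySubset? (λ S → separating? S ×-dec (∣ S ∣ ≤? k))
  ... | yes h with s , p , s≤k ← smallest k h = s , p , m≤n⇒m≤1+n s≤k
  ... | no none = ∣ S ∣ , ((S , sep , refl) , λ S′ sep′ →
      ≤-trans le (≰⇒> λ le′ → none (S′ , sep′ , le′))) , le

  class-≤ : ∀ {a S} → (∀ v → c v ≡ a → lookup S v ≡ true) → length (colourClass c a) ≤ ∣ S ∣
  class-≤ {a} {S} h = begin
    length (colourClass c a)            ≡⟨ length-filter-tabulate (λ v → c v ≟ᶜ a) id ⟩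
    count (λ v → does (c v ≟ᶜ a))       ≤⟨ count-mono (λ v e → h v (does-true (c v ≟ᶜ a) e)) ⟩
    count (lookup S)                    ≡⟨ ∣p∣≡count S ⟨
    ∣ S ∣                               ∎
    where open ≤-Reasoning

  -- Closed neighbourhoods are singletons, so only r or b can split r from b. If one red vertex is
  -- missing from S, every blue vertex must be in S.
  edgeless-≤ : (∀ u v → ¬ u ~ v) → ∀ S → Separating G c S → length R ⊓ length B ≤ ∣ S ∣
  edgeless-≤ none S sep with all? (λ v → (c v ≟ᶜ red) →-dec (lookup S v Bool.≟ true))
  ... | yes h = ≤-trans (m⊓n≤m _ _) (class-≤ {red} {S} h)
  ... | no ¬h with ¬∀⟶∃¬ n _ (λ v → (c v ≟ᶜ red) →-dec (lookup S v Bool.≟ true)) ¬h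
  ...   | r , ¬r = ≤-trans (m⊓n≤n (length R) (length B)) (class-≤ {blue} {S} blue-in)
    where
    r-red : c r ≡ red
    r-red = decidable-stable (c r ≟ᶜ red) λ ne → ¬r (⊥-elim ∘ ne)
    blue-in : ∀ b → c b ≡ blue → lookup S b ≡ true
    blue-in b cb with v , v∈S , ne ← separating⇒splits {S} sep r b r-red cb = cases (v Fin.≟ b) (v Fin.≟ r)
      where
      cases : Dec (v ≡ b) → Dec (v ≡ r) → lookup S b ≡ true
      cases (yes refl) _          = v∈S
      cases (no _)     (yes refl) = ⊥-elim (¬r λ _ → v∈S)
      cases (no v≢b)   (no v≢r)   = ⊥-elim (ne (trans (nb-far v≢r (none r v)) (sym (nb-far v≢b (none b v)))))

-- Size of the search tree

binomial : ℕ → ℕ → ℕ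
binomial n       zero    = 1
binomial zero    (suc k) = 0
binomial (suc n) (suc k) = binomial n k + binomial n (suc k)

-- Two terms of the binomial expansion of the right-hand side; they match the two terms of Pascal's
-- rule below.
bernoulli : ∀ y i → suc i * y ^ i + y ^ suc i ≤ suc y ^ suc i
bernoulli y zero    = ≤-reflexive (arith y)
  where
  arith : ∀ y → 1 * 1 + y * 1 ≡ suc y * 1
  arith = solve-∀
bernoulli y (suc i) = begin
  suc (suc i) * (y * p) + y * (y * p)                     ≤⟨ m≤m+n _ (suc i * p) ⟩
  suc (suc i) * (y * p) + y * (y * p) + suc i * p         ≡⟨ arith y i p ⟩
  suc y * (suc i * p + y * p)                             ≤⟨ *-monoʳ-≤ (suc y) (bernoulli y i) ⟩
  suc y * suc y ^ suc i                                   ∎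
  where
  open ≤-Reasoning
  p = y ^ i
  arith : ∀ y i p → suc (suc i) * (y * p) + y * (y * p) + suc i * p ≡ suc y * (suc i * p + y * p)
  arith = solve-∀

-- The left-hand side is the falling factorial of y of length i.
factorial*binomial≤^ : ∀ y i → (i !) * binomial y i ≤ y ^ i
factorial*binomial≤^ y       zero    = ≤-refl
factorial*binomial≤^ zero    (suc i) = ≤-reflexive (*-zeroʳ (suc i !))
factorial*binomial≤^ (suc y) (suc i) = begin
  suc i * f * (binomial y i + binomial y (suc i))
    ≡⟨ arith (suc i) f (binomial y i) (binomial y (suc i)) ⟩
  suc i * (f * binomial y i) + suc i * f * binomial y (suc i)
    ≤⟨ +-mono-≤ (*-monoʳ-≤ (suc i) (factorial*binomial≤^ y i)) (factorial*binomial≤^ y (suc i)) ⟩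
  suc i * y ^ i + y ^ suc i
    ≤⟨ bernoulli y i ⟩
  suc y ^ suc i ∎
  where
  open ≤-Reasoning
  f = i !
  arith : ∀ a b c d → a * b * (c + d) ≡ a * (b * c) + a * b * d
  arith = solve-∀

binomials : ℕ → ℕ → ℕ
binomials n zero    = 1
binomials n (suc k) = binomials n k + binomial n (suc k)

binomials-suc : ∀ n k → binomials (suc n) (suc k) ≡ binomials n k + binomials n (suc k)
binomials-suc n zero    = refl
binomials-suc n (suc k) = trans (cong (_+ binomial (suc n) (2 + k)) (binomials-suc n k))
  (arith (binomials n k) (binomials n (suc k)) (binomial n (suc k)) (binomial n (2 + k)))
  where
  arith : ∀ a b c d → a + b + (c + d) ≡ a + c + (b + d)
  arith = solve-∀

binomials-zero : ∀ k → binomials 0 k ≡ 1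
binomials-zero zero    = refl
binomials-zero (suc k) = trans (+-identityʳ _) (binomials-zero k)

-- Each of the k + 1 terms `(k !) * binomial y i` is at most `y ^ k`: the part `i !` turns the
-- binomial into at most `y ^ i`, and the other k - i factors of `k !` are at most k ≤ y.
factorial*binomials≤ : ∀ k y → k ≤ y → (k !) * binomials y k ≤ suc k * y ^ k
factorial*binomials≤ k y k≤y = go k k≤y
  where
  open ≤-Reasoning
  arith : ∀ a b c d → a * b * (c + d) ≡ a * (b * c) + a * b * d
  arith = solve-∀
  arith′ : ∀ i y p → suc i * (y * p) + y * p ≡ suc (suc i) * (y * p)
  arith′ = solve-∀
  swap : ∀ a b c → a * (b * c) ≡ b * (a * c)
  swap = solve-∀
  go : ∀ i → i ≤ y → (i !) * binomials y i ≤ suc i * y ^ i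
  go zero    _   = ≤-refl
  go (suc i) i<y = begin
    suc i * (i !) * (binomials y i + binomial y (suc i))
      ≡⟨ arith (suc i) (i !) (binomials y i) (binomial y (suc i)) ⟩
    suc i * ((i !) * binomials y i) + (suc i !) * binomial y (suc i)
      -- The new factor `suc i` of the factorial is traded for one more factor y.
      ≤⟨ +-mono-≤ (*-mono-≤ i<y (go i (<⇒≤ i<y))) (factorial*binomial≤^ y (suc i)) ⟩
    y * (suc i * y ^ i) + y ^ suc i
      ≡⟨ trans (cong (_+ y ^ suc i) (swap y (suc i) (y ^ i))) (arith′ i y (y ^ i)) ⟩
    suc (suc i) * y ^ suc i ∎

-- Increased by 1, `visits` satisfies Pascal's rule exactly, as do the partial row sums `binomials`.
-- Only the boundary cases have to be compared, and the factor 2 comes from them.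
suc-visits≤ : ∀ j y → suc (visits j y) ≤ 2 * binomials y (suc j)
suc-visits≤ j       zero    = ≤-reflexive (cong (2 *_) (sym (binomials-zero (suc j))))
suc-visits≤ zero    (suc y) = begin
  suc (1 + visits zero y)                       ≤⟨ s≤s (suc-visits≤ zero y) ⟩
  1 + 2 * binomials y 1                         ≤⟨ n≤1+n (1 + 2 * binomials y 1) ⟩
  2 * binomials y 0 + 2 * binomials y 1         ≡⟨ *-distribˡ-+ 2 (binomials y 0) (binomials y 1) ⟨
  2 * (binomials y 0 + binomials y 1)           ≡⟨ cong (2 *_) (binomials-suc y 0) ⟨
  2 * binomials (suc y) 1                       ∎
  where open ≤-Reasoning
suc-visits≤ (suc j) (suc y) = begin
  suc (1 + (visits j y + visits (suc j) y))               ≡⟨ cong suc (+-suc (visits j y) _) ⟨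
  suc (visits j y) + suc (visits (suc j) y)               ≤⟨ +-mono-≤ (suc-visits≤ j y) (suc-visits≤ (suc j) y) ⟩
  2 * binomials y (suc j) + 2 * binomials y (2 + j)       ≡⟨ *-distribˡ-+ 2 (binomials y (suc j)) _ ⟨
  2 * (binomials y (suc j) + binomials y (2 + j))         ≡⟨ cong (2 *_) (binomials-suc y (suc j)) ⟨
  2 * binomials (suc y) (2 + j)                           ∎
  where open ≤-Reasoning

-- The quotient of the two sides without the 16 is largest at k = 2, where it is 27/2. The inductive
-- step needs (k + 2)^3 ≤ (k + 1)^4, which holds from k = 2 on; hence three base cases.
cube≤factorial : ∀ k → suc k * (suc k * suc k) ≤ 16 * (k !)
cube≤factorial 0 = s≤s z≤n
cube≤factorial 1 = ≤ᵇ⇒≤ 8 16 tt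
cube≤factorial 2 = ≤ᵇ⇒≤ 27 32 tt
cube≤factorial (suc k@(suc (suc i))) = begin
  suc (suc k) * (suc (suc k) * suc (suc k))     ≤⟨ m≤m+n _ (slack i) ⟩
  suc (suc k) * (suc (suc k) * suc (suc k)) + slack i
                                                ≡⟨ arith i ⟩
  suc k * (suc k * (suc k * suc k))             ≤⟨ *-monoʳ-≤ (suc k) (cube≤factorial k) ⟩
  suc k * (16 * (k !))                    ≡⟨ swap (suc k) 16 (k !) ⟩
  16 * (suc k !)                        ∎
  where
  open ≤-Reasoning
  slack : ℕ → ℕ
  -- The difference (i + 3)^4 - (i + 4)^3 for k = i + 2; its coefficients are all positive.
  slack i = i * i * i * i + 11 * (i * i * i) + 42 * (i * i) + 60 * i + 17
  arith : ∀ i → (4 + i) * ((4 + i) * (4 + i)) + (i * i * i * i + 11 * (i * i * i) + 42 * (i * i) + 60 * i + 17)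
          ≡ (3 + i) * ((3 + i) * ((3 + i) * (3 + i)))
  arith = solve-∀
  swap : ∀ a b c → a * (b * c) ≡ b * (a * c)
  swap = solve-∀

-- If k + 1 = e then h ≤ k + 1 and the factor h is absorbed by k!; otherwise it
-- is absorbed by one more factor n.
search-cost : ∀ n h k e → h ≤ e → suc k ≤ e → 1 ≤ h → h ≤ n → k < n →
              h * (n * (suc k * binomials n k)) ≤ 16 * n ^ e
search-cost n h k e h≤e k<e 1≤h h≤n k<n =
  *-cancelˡ-≤ f {{f≢0}} (begin
    f * (h * (n * (suc k * binomials n k)))     ≡⟨ arith₁ f h n (suc k) (binomials n k) ⟩
    h * (n * (suc k * (f * binomials n k)))     ≤⟨ *-monoʳ-≤ h (*-monoʳ-≤ n (*-monoʳ-≤ (suc k)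
                                                      (factorial*binomials≤ k n (<⇒≤ k<n)))) ⟩
    h * (n * (suc k * (suc k * n ^ k)))         ≤⟨ cases (m≤n⇒m<n∨m≡n k<e) ⟩
    16 * f * n ^ e                              ≡⟨ arith₂ 16 f (n ^ e) ⟩
    f * (16 * n ^ e)                            ∎)
  where
  open ≤-Reasoning
  f = k !
  f≢0 : NonZero f
  f≢0 = >-nonZero (positive k)
    where
    positive : ∀ k → 1 ≤ (k !)
    positive zero    = ≤-refl
    positive (suc k) = ≤-trans (positive k) (m≤m+n _ (k * (k !)))
  arith₁ : ∀ f h n s b → f * (h * (n * (s * b))) ≡ h * (n * (s * (f * b)))
  arith₁ = solve-∀
  arith₂ : ∀ a b c → a * b * c ≡ b * (a * c)
  arith₂ = solve-∀
  arith₃ : ∀ h n s p → h * (n * (s * (s * p))) ≡ h * (s * s) * (n * p)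
  arith₃ = solve-∀
  square≤ : suc k * suc k ≤ 16 * f
  square≤ = ≤-trans (m≤m+n _ (k * (suc k * suc k))) (cube≤factorial k)
  n≢0 : NonZero n
  n≢0 = >-nonZero (≤-trans 1≤h h≤n)
  cases : suc k < e ⊎ suc k ≡ e → h * (n * (suc k * (suc k * n ^ k))) ≤ 16 * f * n ^ e
  cases (inj₂ refl) = begin
    h * (n * (suc k * (suc k * n ^ k)))   ≡⟨ arith₃ h n (suc k) (n ^ k) ⟩
    h * (suc k * suc k) * (n * n ^ k)     ≤⟨ *-monoˡ-≤ (n ^ suc k) (*-monoˡ-≤ (suc k * suc k) h≤e) ⟩
    suc k * (suc k * suc k) * n ^ suc k   ≤⟨ *-monoˡ-≤ (n ^ suc k) (cube≤factorial k) ⟩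
    16 * f * n ^ suc k                    ∎
  cases (inj₁ 2+k≤e) = begin
    h * (n * (suc k * (suc k * n ^ k)))       ≤⟨ *-monoˡ-≤ _ h≤n ⟩
    n * (n * (suc k * (suc k * n ^ k)))       ≡⟨ arith₅ n (suc k) (n ^ k) ⟩
    suc k * suc k * (n * (n * n ^ k))         ≤⟨ *-mono-≤ square≤ (^-monoʳ-≤ n {{n≢0}} 2+k≤e) ⟩
    16 * f * n ^ e                            ∎
    where
    arith₅ : ∀ n s p → n * (n * (s * (s * p))) ≡ s * s * (n * (n * p))
    arith₅ = solve-∀

-- The encoded input

contents-++ : ∀ xs {ys i j} → i ≡ length xs + j → contents (xs ++ ys) i ≡ contents ys j
contents-++ []       refl = refl
contents-++ (_ ∷ xs) refl = contents-++ xs refl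

contents-beyond : ∀ xs i → length xs ≤ i → contents xs i ≡ 0
contents-beyond []       i       _       = refl
contents-beyond (_ ∷ xs) (suc i) (s≤s p) = contents-beyond xs i p

length-encodeVertices : ∀ {n} (xs : List (Fin n)) → length (concatMap encodeVertex xs) ≡ length xs
length-encodeVertices []       = refl
length-encodeVertices (x ∷ xs) = cong suc (length-encodeVertices xs)

length-encodeEdges : ∀ {n} (xs : List (Fin n × Fin n)) →
                     length (concatMap encodeEdge xs) ≡ length xs + length xs
length-encodeEdges []       = refl
length-encodeEdges (x ∷ xs) = cong suc (trans (cong suc (length-encodeEdges xs)) (sym (+-suc _ _)))

-- Membership in both directions is all that the tests depend on; the order of the list is
-- forgotten.
Lists : ∀ {n} → (Addr → ℕ) → Addr → List (Fin n) → Set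
Lists μ a xs = (∀ j → j < length xs → ∃[ v ] v ∈ xs × μ (a + j) ≡ toℕ v)
             × (∀ v → v ∈ xs → ∃[ j ] j < length xs × μ (a + j) ≡ toℕ v)

ListsEdges : ∀ {n} → (Addr → ℕ) → Addr → List (Fin n × Fin n) → Set
ListsEdges μ a es =
    (∀ j → j < length es → ∃[ u ] ∃[ v ] (u , v) ∈ es × μ (a + j + j) ≡ toℕ u × μ (a + j + j + 1) ≡ toℕ v)
  × (∀ u v → (u , v) ∈ es → ∃[ j ] j < length es × μ (a + j + j) ≡ toℕ u × μ (a + j + j + 1) ≡ toℕ v)

lists-encodeVertices : ∀ {n} (xs : List (Fin n)) ys → Lists (contents (concatMap encodeVertex xs ++ ys)) 0 xs
lists-encodeVertices []       ys = (λ _ ()) , (λ _ ())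
lists-encodeVertices (x ∷ xs) ys with l , r ← lists-encodeVertices xs ys = left , right
  where
  left : ∀ j → j < suc (length xs) → ∃[ v ] v ∈ x ∷ xs × _ ≡ toℕ v
  left zero    _       = x , here refl , refl
  left (suc j) (s≤s p) with v , q , e ← l j p = v , there q , e
  right : ∀ v → v ∈ x ∷ xs → ∃[ j ] j < suc (length xs) × contents (concatMap encodeVertex (x ∷ xs) ++ ys) j ≡ toℕ v
  right v (here refl) = 0 , s≤s z≤n , refl
  right v (there q) with j , p , e ← r v q = suc j , s≤s p , e

lists-encodeEdges : ∀ {n} (es : List (Fin n × Fin n)) → ListsEdges (contents (concatMap encodeEdge es)) 0 es
lists-encodeEdges []             = (λ _ ()) , (λ _ _ ())
lists-encodeEdges {n} ((u , v) ∷ es) with l , r ← lists-encodeEdges es = left , right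
  where
  μ μ′ : Addr → ℕ
  μ  = contents (concatMap encodeEdge es)
  μ′ = contents (concatMap encodeEdge ((u , v) ∷ es))
  shift : ∀ j → μ′ (suc j + suc j) ≡ μ (j + j)
  shift j = cong μ′ (cong suc (+-suc j j))
  shift′ : ∀ j → μ′ (suc j + suc j + 1) ≡ μ (j + j + 1)
  shift′ j = cong μ′ (cong (λ q → suc (q + 1)) (+-suc j j))
  left : ∀ j → j < suc (length es) → ∃[ a ] ∃[ b ] (a , b) ∈ (u , v) ∷ es × μ′ (j + j) ≡ toℕ a × μ′ (j + j + 1) ≡ toℕ b
  left zero    _       = u , v , here refl , refl , refl
  left (suc j) (s≤s p) with a , b , q , e , e′ ← l j p =
    a , b , there q , trans (shift j) e , trans (shift′ j) e′
  right : ∀ a b → (a , b) ∈ (u , v) ∷ es → ∃[ j ] j < suc (length es) × μ′ (j + j) ≡ toℕ a × μ′ (j + j + 1) ≡ toℕ b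
  right a b (here refl) = 0 , s≤s z≤n , refl , refl
  right a b (there q) with j , p , e , e′ ← r a b q =
    suc j , s≤s p , trans (shift j) e , trans (shift′ j) e′

lists-move : ∀ {n} (μ μ′ : Addr → ℕ) a a′ {xs : List (Fin n)} →
             (∀ j → j < length xs → μ′ (a′ + j) ≡ μ (a + j)) → Lists μ a xs → Lists μ′ a′ xs
lists-move μ μ′ a a′ h (l , r) =
  (λ j p → case l j p of λ { (v , q , e) → v , q , trans (h j p) e })
  , (λ v q → case r v q of λ { (j , p , e) → j , p , trans (h j p) e })

listsEdges-move : ∀ {n} (μ μ′ : Addr → ℕ) a a′ {es : List (Fin n × Fin n)} →
  (∀ i → i < length es + length es → μ′ (a′ + i) ≡ μ (a + i)) → ListsEdges μ a es → ListsEdges μ′ a′ es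
listsEdges-move μ μ′ a a′ {es} h (l , r) =
  (λ j p → case l j p of λ { (u , v , q , e , e′) → u , v , q , trans (even j p) e , trans (odd j p) e′ })
  , (λ u v q → case r u v q of λ { (j , p , e , e′) → j , p , trans (even j p) e , trans (odd j p) e′ })
  where
  j+j<m+m : ∀ j → j < length es → j + j + 1 < length es + length es
  j+j<m+m j p = ≤-trans (≤-reflexive (arith j)) (+-mono-≤ p p)
    where
    arith : ∀ j → suc (j + j + 1) ≡ suc j + suc j
    arith = solve-∀
  even : ∀ j → j < length es → μ′ (a′ + j + j) ≡ μ (a + j + j)
  even j p = trans (cong μ′ (+-assoc a′ j j))
    (trans (h (j + j) (≤-trans (s≤s (m≤m+n (j + j) 1)) (j+j<m+m j p))) (cong μ (sym (+-assoc a j j))))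
  odd : ∀ j → j < length es → μ′ (a′ + j + j + 1) ≡ μ (a + j + j + 1)
  odd j p = trans (cong μ′ (arith a′ j)) (trans (h (j + j + 1) (j+j<m+m j p)) (cong μ (sym (arith a j))))
    where
    arith : ∀ a j → a + j + j + 1 ≡ a + (j + j + 1)
    arith = solve-∀

signOf magnitude : ℤ → ℕ
signOf (+ _)       = 0
signOf -[1+ _ ]    = 1
magnitude (+ m)    = m
magnitude -[1+ m ] = suc m

encodeℤ-parts : ∀ k → encodeℤ k ≡ signOf k ∷ magnitude k ∷ []
encodeℤ-parts (+ _)    = refl
encodeℤ-parts -[1+ _ ] = refl

-- Soundness and completeness of the search

all⁻ : ∀ {A : Set} (p : A → Bool) xs → all p xs ≡ true → ∀ {x} → x ∈ xs → p x ≡ true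
all⁻ p (x ∷ xs) e (here refl) with p x | e
... | true  | _ = refl
all⁻ p (x ∷ xs) e (there q) with p x | e
... | true  | e′ = all⁻ p xs e′ q

all⁺ : ∀ {A : Set} (p : A → Bool) xs → (∀ {x} → x ∈ xs → p x ≡ true) → all p xs ≡ true
all⁺ p []       h = refl
all⁺ p (x ∷ xs) h rewrite h (here refl) = all⁺ p xs (h ∘ there)

iff-≡ : ∀ {a b} → (a ≡ true → b ≡ true) → (b ≡ true → a ≡ true) → a ≡ b
iff-≡ {true}  {b}     f g = sym (f refl)
iff-≡ {false} {true}  f g = g refl
iff-≡ {false} {false} f g = refl

-- The stack on which the search meets the set s: its largest element is pushed first, so the list
-- ends up in increasing order from its head.
elements : (ℕ → Bool) → ℕ → List ℕ → List ℕ
elements s zero    L = L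
elements s (suc y) L = if s y then elements s y (y ∷ L) else elements s y L

module _ (chk : List ℕ → Bool) where

  foundBelow-sound : ∀ j x L → foundBelow chk j x L ≡ true →
    ∃[ M ] chk M ≡ true × length M ≤ suc j + length L × (∀ {n} → x ≤ n → All (_< n) L → All (_< n) M)
  foundBelow-sound zero (suc y) L e with chk (y ∷ L) in c
  ... | true  = y ∷ L , c , ≤-refl , λ y<n L<n → y<n ∷ L<n
  ... | false with M , cM , le , a ← foundBelow-sound zero y L e = M , cM , le , λ y<n → a (<⇒≤ y<n)
  foundBelow-sound (suc j) (suc y) L e with chk (y ∷ L) in c
  ... | true  = y ∷ L , c , s≤s (m≤n+m _ (suc j)) , λ y<n L<n → y<n ∷ L<n
  ... | false with foundBelow chk j y (y ∷ L) in d
  ...   | true with M , cM , le , a ← foundBelow-sound j y (y ∷ L) d =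
            M , cM , ≤-trans le (≤-reflexive (+-suc (suc j) (length L))) , λ y<n L<n → a (<⇒≤ y<n) (y<n ∷ L<n)
  ...   | false with M , cM , le , a ← foundBelow-sound (suc j) y L e = M , cM , le , λ y<n → a (<⇒≤ y<n)

  foundFrom-sound : ∀ k n → foundFrom chk k n [] ≡ true → ∃[ M ] chk M ≡ true × length M ≤ k × All (_< n) M
  foundFrom-sound zero    n e = [] , e , z≤n , []
  foundFrom-sound (suc j) n e with chk [] in c
  ... | true  = [] , c , z≤n , []
  ... | false with M , cM , le , a ← foundBelow-sound j n [] e =
        M , cM , ≤-trans le (≤-reflexive (+-identityʳ (suc j))) , a ≤-refl []

  -- The path to s through the search tree is followed downwards: at y, the entry is lowered past y
  -- when y is not in s, and otherwise y is kept and a new level opened. The levels suffice because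
  -- s has at most j elements below x.
  foundFrom-complete : ∀ (s : ℕ → Bool) j x L → sumBelow (bit ∘ s) x ≤ j →
    chk (elements s x L) ≡ true → foundFrom chk j x L ≡ true
  foundFrom-complete s = go
    where
    start : ∀ j x L → chk L ≡ true → foundFrom chk j x L ≡ true
    start zero    x L c = c
    start (suc j) x L c rewrite c = refl
    skipping : ∀ j y L → foundFrom chk j y L ≡ true → foundFrom chk j (suc y) L ≡ true
    skipping zero          y L e = e
    skipping (suc zero)    y L e with chk L
    ... | true  = refl
    ... | false = trans (cong (chk (y ∷ L) ∨_) e) (∨-zeroʳ _)
    skipping (suc (suc j)) y L e with chk L
    ... | true  = refl
    ... | false = trans (cong ((chk (y ∷ L) ∨ foundBelow chk j y (y ∷ L)) ∨_) e) (∨-zeroʳ _)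
    taking : ∀ j y L → foundFrom chk j y (y ∷ L) ≡ true → foundFrom chk (suc j) (suc y) L ≡ true
    taking zero    y L e rewrite e = ∨-zeroʳ _
    taking (suc j) y L e rewrite e = ∨-zeroʳ _
    go : ∀ j x L → sumBelow (bit ∘ s) x ≤ j → chk (elements s x L) ≡ true → foundFrom chk j x L ≡ true
    go j zero    L _  c = start j 0 L c
    go j (suc y) L le c with s y
    ... | false = skipping j y L (go j y L le c)
    go (suc j) (suc y) L (s≤s le) c | true = taking j y L (go j y (y ∷ L) le c)

elements-keeps : ∀ s x L {v} → v ∈ L → v ∈ elements s x L
elements-keeps s zero    L p = p
elements-keeps s (suc y) L p with s y
... | true  = elements-keeps s y (y ∷ L) (there p)
... | false = elements-keeps s y L p

∈-elements : ∀ s x L {v} → v < x → s v ≡ true → v ∈ elements s x L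
∈-elements s (suc y) L {v} v<1+y e with v ≟ y
... | yes refl rewrite e = elements-keeps s y (y ∷ L) (here refl)
... | no v≢y with s y
...   | true  = ∈-elements s y (y ∷ L) (≤∧≢⇒< (≤-pred v<1+y) v≢y) e
...   | false = ∈-elements s y L (≤∧≢⇒< (≤-pred v<1+y) v≢y) e

elements-< : ∀ s x L {n} → x ≤ n → All (_< n) L → All (_< n) (elements s x L)
elements-< s zero    L _ a = a
elements-< s (suc y) L y<n a with s y
... | true  = elements-< s y (y ∷ L) (<⇒≤ y<n) (y<n ∷ a)
... | false = elements-< s y L (<⇒≤ y<n) a

sumBelow-front : ∀ f n → sumBelow f (suc n) ≡ f 0 + sumBelow (f ∘ suc) n
sumBelow-front f zero    = refl
sumBelow-front f (suc n) = trans (cong (_+_ (f (suc n))) (sumBelow-front f n)) (swap (f (suc n)) (f 0) _)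
  where
  swap : ∀ a b c → a + (b + c) ≡ b + (a + c)
  swap = solve-∀

sumBelow-count : ∀ {n} f (g : Fin n → Bool) → (∀ i → f (toℕ i) ≡ bit (g i)) → sumBelow f n ≡ count g
sumBelow-count {zero}  f g h = refl
sumBelow-count {suc n} f g h = trans (sumBelow-front f n)
  (cong₂ _+_ (h zero) (sumBelow-count (f ∘ suc) (g ∘ suc) (h ∘ suc)))

maxBelow-front : ∀ f n → maxBelow f (suc n) ≡ f 0 ⊔ maxBelow (f ∘ suc) n
maxBelow-front f zero    = refl
maxBelow-front f (suc n) = trans (cong (f (suc n) ⊔_) (maxBelow-front f n))
  (trans (sym (⊔-assoc (f (suc n)) (f 0) _))
  (trans (cong (_⊔ maxBelow (f ∘ suc) n) (⊔-comm (f (suc n)) (f 0))) (⊔-assoc (f 0) (f (suc n)) _)))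

maxBelow-foldr : ∀ {n} {A : Set} f (d : A → ℕ) (g : Fin n → A) → (∀ i → f (toℕ i) ≡ d (g i)) →
                 maxBelow f n ≡ foldr _⊔_ 0 (map d (tabulate g))
maxBelow-foldr {zero}  f d g h = refl
maxBelow-foldr {suc n} f d g h = trans (maxBelow-front f n)
  (cong₂ _⊔_ (h zero) (maxBelow-foldr (f ∘ suc) d (g ∘ suc) (h ∘ suc)))

module Checking {n : ℕ} (G : Graph n) (c : Colouring n) (T A b : Addr) where
  open Neighbourhoods G
  open Separation G c

  record Ready (μ : Addr → ℕ) : Set where
    field
      -- The red list is preceded by four words: the order, the sign and the magnitude of k, and the
      -- length of the list.
      reds  : Lists μ 4 R
      blues : Lists μ b B
      rows  : ∀ (x : Fin n) → μ (T + toℕ x) ≡ A + toℕ x * n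
      cells : ∀ x v → μ (A + toℕ x * n + toℕ v) ≡ bit (nb x v)

  DifferIn : List ℕ → Fin n → Fin n → Set
  DifferIn L x y = ∃[ v ] toℕ v ∈ L × nb x v ≢ nb y v

  module _ {μ : Addr → ℕ} (ready : Ready μ) where
    open Ready ready

    distance-zero : ∀ L → All (_< n) L → ∀ x y →
                    (nonzero (distance μ (μ (T + toℕ x)) (μ (T + toℕ y)) L) ≡ true → DifferIn L x y)
                    × (DifferIn L x y → nonzero (distance μ (μ (T + toℕ x)) (μ (T + toℕ y)) L) ≡ true)
    distance-zero L L<n x y rewrite rows x | rows y = go L L<n
      where
      X Y : Addr
      X = A + toℕ x * n
      Y = A + toℕ y * n
      go : ∀ L → All (_< n) L → (nonzero (distance μ X Y L) ≡ true → DifferIn L x y)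
                              × (DifferIn L x y → nonzero (distance μ X Y L) ≡ true)
      go []       []         = (λ ()) , λ ()
      -- The number `w` is first replaced by `toℕ v`, to which the description of the matrix cells
      -- applies.
      go (w ∷ L) (w<n ∷ L<n)
        with v ← fromℕ< w<n in ev
        with refl ← trans (sym (toℕ-fromℕ< w<n)) (cong toℕ ev)
        rewrite cells x v | cells y v
        with f , g ← go L L<n
        with nb x v in ex | nb y v in ey
      ... | true  | false = (λ _ → v , here refl , split {x} {y} ex ey) , λ _ → refl
      ... | false | true  = (λ _ → v , here refl , split′ {x} {y} ex ey) , λ _ → refl
      ... | true  | true  = (λ e → case f e of λ { (u , p , ne) → u , there p , ne }) , λ where
        (u , there p , ne) → g (u , p , ne)
        (u , here e , ne)  → ⊥-elim (ne (subst (λ u → nb x u ≡ nb y u) (sym (toℕ-injective e)) (trans ex (sym ey))))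
      ... | false | false = (λ e → case f e of λ { (u , p , ne) → u , there p , ne }) , λ where
        (u , there p , ne) → g (u , p , ne)
        (u , here e , ne)  → ⊥-elim (ne (subst (λ u → nb x u ≡ nb y u) (sym (toℕ-injective e)) (trans ex (sym ey))))

    separatesIn-sound : ∀ L → All (_< n) L → separatesIn μ T 4 (length R) b (length B) L ≡ true →
                        ∀ r b → c r ≡ red → c b ≡ blue → DifferIn L r b
    separatesIn-sound L L<n e r y cr cy
      with j , j<R , er ← proj₂ reds r (∈-class cr)
      with i , i<B , ey ← proj₂ blues y (∈-class cy) =
      proj₁ (distance-zero L L<n r y)
        (all⁻ (λ q → nonzero (distance μ (μ (T + toℕ r)) (μ (T + q)) L)) _
          (all⁻ _ _ e (subst (_∈ arr μ 4 (length R)) er (∈-arr⁺ (length R) j<R)))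
          (subst (_∈ arr μ b (length B)) ey (∈-arr⁺ (length B) i<B)))

    separatesIn-complete : ∀ L → All (_< n) L → (∀ r b → c r ≡ red → c b ≡ blue → DifferIn L r b) →
                           separatesIn μ T 4 (length R) b (length B) L ≡ true
    separatesIn-complete L L<n h = all⁺ _ _ λ {p} p∈ → all⁺ _ _ λ {q} q∈ → inner p∈ q∈
      where
      inner : ∀ {p q} → p ∈ arr μ 4 (length R) → q ∈ arr μ b (length B) →
              nonzero (distance μ (μ (T + p)) (μ (T + q)) L) ≡ true
      inner p∈ q∈ with j , j<R , refl ← ∈-arr⁻ (length R) p∈
                  with i , i<B , refl ← ∈-arr⁻ (length B) q∈
                  with r , r∈ , er ← proj₁ reds j j<R
                  with y , y∈ , ey ← proj₁ blues i i<B
                  rewrite er | ey =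
        proj₂ (distance-zero L L<n r y) (h r y (∈-class⁻ r∈) (∈-class⁻ y∈))

  fins : ∀ {M} → All (_< n) M → List (Fin n)
  fins []        = []
  fins (v<n ∷ a) = fromℕ< v<n ∷ fins a

  length-fins : ∀ {M} (a : All (_< n) M) → length (fins a) ≡ length M
  length-fins []      = refl
  length-fins (_ ∷ a) = cong suc (length-fins a)

  ∈-fins : ∀ {M v} (a : All (_< n) M) → toℕ v ∈ M → v ∈ fins a
  ∈-fins (v<n ∷ a) (here e)  = here (toℕ-injective (trans e (sym (toℕ-fromℕ< v<n))))
  ∈-fins (_ ∷ a)   (there p) = there (∈-fins a p)

  indicator : Subset n → ℕ → Bool
  indicator S i with i <? n
  ... | yes i<n = lookup S (fromℕ< i<n)
  ... | no _    = false

  indicator-toℕ : ∀ S v → indicator S (toℕ v) ≡ lookup S v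
  indicator-toℕ S v with toℕ v <? n
  ... | yes v<n = cong (lookup S) (fromℕ<-toℕ v v<n)
  ... | no v≮n  = ⊥-elim (v≮n (toℕ<n v))

  module _ {μ : Addr → ℕ} (ready : Ready μ) (k : ℕ) where

    private
      chk : List ℕ → Bool
      chk = separatesIn μ T 4 (length R) b (length B)

    found⇒separable : foundFrom chk k n [] ≡ true → SeparableBy k
    found⇒separable e
      with M , cM , M≤k , M<n ← foundFrom-sound chk k n e
      with S , sep , S≤ ← separating-list (fins M<n) (λ r y cr cy →
             case separatesIn-sound ready M M<n cM r y cr cy of λ
               { (v , v∈M , ne) → v , ∈-fins M<n v∈M , ne }) =
      S , sep , ≤-trans S≤ (≤-trans (≤-reflexive (length-fins M<n)) M≤k)

    separable⇒found : SeparableBy k → foundFrom chk k n [] ≡ true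
    separable⇒found (S , sep , S≤k) =
      foundFrom-complete chk s k n []
        (≤-trans (≤-reflexive (trans
          (sumBelow-count (bit ∘ s) (lookup S) (λ i → cong bit (indicator-toℕ S i)))
          (sym (∣p∣≡count S)))) S≤k)
        (separatesIn-complete ready (elements s n []) (elements-< s n [] ≤-refl []) λ r y cr cy →
          case separating⇒splits {S} sep r y cr cy of λ
            { (v , v∈S , ne) → v , ∈-elements s n [] (toℕ<n v) (trans (indicator-toℕ S v) v∈S) , ne })
      where
      s = indicator S

-- The decision procedure

setup : Program
setup =
  rOne ≔ 1 ⨾ #V ≔[ ans ] ⨾ u₁ ≔[ rOne ] ⨾
  tmp ≔ 2 ⨾ rK ≔[ tmp ] ⨾
  tmp ≔ 3 ⨾ #R ≔[ tmp ] ⨾ aR ≔ 4 ⨾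
  (tmp ≔ aR ⊕ #R) ⨾ #B ≔[ tmp ] ⨾ (aB ≔ tmp ⊕ rOne) ⨾
  (tmp ≔ aB ⊕ #B) ⨾ #E ≔[ tmp ] ⨾ (aE ≔ tmp ⊕ rOne) ⨾
  (aT ≔ aE ⊕ #E) ⨾ (aT ≔ aT ⊕ #E) ⨾ (aM ≔ aT ⊕ #V) ⨾
  -- Truncated subtraction twice gives the minimum of the two class sizes.
  (tmp ≔ #R ⊖ #B) ⨾ (rH ≔ #R ⊖ tmp)

thresholdStep : Program
thresholdStep = (ctr ≔ ctr ⊖ rOne) ⨾ (u₁ ≔ u₁ ⊕ rMul)

-- The product d h by h additions, which is affordable since h ≤ n.
threshold : Program
threshold = (u₁ ≔ 0 ⨾ (ctr ≔ rH ⊕ ans)) ⨾ (whilenz ctr loop thresholdStep)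

decide : Program
decide =
  (tmp ≔ u₁ ⊖ rK) ⨾
  (ifz tmp then ans ≔ 1 else (
    (tmp ≔ #V ⊖ rK) ⨾
    (ifz tmp then ans ≔ 1 else (search ⨾ (ans ≔ found ⊕ ans)))))

edgeless : Program
edgeless = (tmp ≔ rH ⊖ rK) ⨾ (ifz tmp then ans ≔ 1 else skip)

-- The program mul computes the bound on the number of vertices that tell a
-- given vertex apart from all the others.
solver : Program → Program
solver mul =
  setup ⨾
  (ifz u₁ then
    (ifz rH then ans ≔ 1 else
      (ifz #E then edgeless else
        -- `mul` runs before the diagonal is set, while the row sums of the matrix are still the
        -- degrees.
        (table ⨾ fillEdges ⨾ mul ⨾ fillDiagonal ⨾ threshold ⨾ decide)))
   else skip)

threshold-runs : ∀ σ → reg σ rOne ≡ 1 → reg σ ans ≡ 0 →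
  Runs threshold σ (2 + suc (reg σ rH) * 3) λ τ →
    Agree 20 σ τ × mem τ ≡ mem σ × reg τ u₁ ≡ reg σ rMul * reg σ rH
threshold-runs σ e₁ e₀ =
  block {P = u₁ ≔ 0 ⨾ (ctr ≔ rH ⊕ ans)} {Q = λ τ → Inv h τ × reg τ ctr ≡ h}
    ((agree-refl 20 σ , refl , refl) , plus-zero refl e₀)
  then λ τ (inv , e) → weaken
    (λ { τ (ag , m , u) → ag , m , trans (sym (trans (cong (_+_ (reg τ u₁)) (*-zeroʳ M)) (+-identityʳ _))) u })
    (countdown Inv step h τ e inv)
  where
  h = reg σ rH
  M = reg σ rMul
  Inv : ℕ → State → Set
  Inv i τ = Agree 20 σ τ × mem τ ≡ mem σ × reg τ u₁ + M * i ≡ M * h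
  step : ∀ i τ → reg τ ctr ≡ suc i → Inv (suc i) τ →
         Runs thresholdStep τ 2 λ τ → reg τ ctr ≡ i × Inv i τ
  step i τ₀@(⟪ ρ , _ ⟫) e (ag , refl , u) = block
    ( pred-ctr e (trans (same rOne) e₁) , ag , refl
    , trans (cong (λ q → ρ u₁ + q + M * i) (same rMul))
        (trans (+-assoc (ρ u₁) M (M * i)) (trans (cong (_+_ (ρ u₁)) (sym (*-suc M i))) u)))
    where
    same = kept 20 σ τ₀ ag

-- Arithmetic of the running time

m∸[m∸n]≡m⊓n : ∀ m n → m ∸ (m ∸ n) ≡ m ⊓ n
m∸[m∸n]≡m⊓n m n with ≤-total m n
... | inj₁ m≤n rewrite m≤n⇒m⊓n≡m m≤n | m≤n⇒m∸n≡0 m≤n = refl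
... | inj₂ n≤m rewrite m≥n⇒m⊓n≡n n≤m = m∸[m∸n]≡n n≤m

m⊓n≡0⇒ : ∀ {m n} → 0 < m → 0 < n → m ⊓ n ≢ 0
m⊓n≡0⇒ (s≤s _) (s≤s _) ()

∈⇒0<length : ∀ {A : Set} {x : A} {xs} → x ∈ xs → 0 < length xs
∈⇒0<length (here _)  = s≤s z≤n
∈⇒0<length (there _) = s≤s z≤n

length-cartesianProduct : ∀ {A B : Set} (xs : List A) (ys : List B) →
                          length (cartesianProduct xs ys) ≡ length xs * length ys
length-cartesianProduct []       ys = refl
length-cartesianProduct (x ∷ xs) ys = trans (length-++ (map (x ,_) ys))
  (cong₂ _+_ (length-map (x ,_) ys) (length-cartesianProduct xs ys))

total≤ : ∀ k n → total k n ≤ 2 * binomials n k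
total≤ zero    n = s≤s z≤n
total≤ (suc j) n = suc-visits≤ j n

-- Here f stands for the target power of n. Set-up, matrix and threshold together cost at most 130 f
-- and the search at most 4608 f; 5000 is a round bound.
solving-time : ∀ {f n m h s} → 1 ≤ f → n ≤ f → m ≤ f → h ≤ f → n * n ≤ f → s ≤ 4608 * f →
  (4 + suc n * 5) + ((1 + suc m * 15) + ((2 + suc n * (suc n * 13)) + ((1 + suc n * 6) +
    ((2 + suc h * 3) + (1 + suc (1 + suc (5 + s + 1))))))) ≤ 5000 * f
solving-time {f} {n} {m} {h} {s} 1≤f n≤f m≤f h≤f q≤f s≤f = begin
  (4 + suc n * 5) + ((1 + suc m * 15) + ((2 + suc n * (suc n * 13)) + ((1 + suc n * 6) +
    ((2 + suc h * 3) + (1 + suc (1 + suc (5 + s + 1)))))))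
    ≡⟨ arith n m h s ⟩
  62 * 1 + 37 * n + 15 * m + 3 * h + 13 * (n * n) + s
    ≤⟨ +-mono-≤ (+-mono-≤ (+-mono-≤ (+-mono-≤ (+-mono-≤
         (*-monoʳ-≤ 62 1≤f) (*-monoʳ-≤ 37 n≤f)) (*-monoʳ-≤ 15 m≤f)) (*-monoʳ-≤ 3 h≤f)) (*-monoʳ-≤ 13 q≤f)) s≤f ⟩
  62 * f + 37 * f + 15 * f + 3 * f + 13 * f + 4608 * f
    ≡⟨ arith′ f ⟩
  4738 * f
    ≤⟨ *-monoˡ-≤ f (≤ᵇ⇒≤ 4738 5000 tt) ⟩
  5000 * f ∎
  where
  open ≤-Reasoning
  arith : ∀ n m h s →
    (4 + suc n * 5) + ((1 + suc m * 15) + ((2 + suc n * (suc n * 13)) + ((1 + suc n * 6) +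
    ((2 + suc h * 3) + (1 + suc (1 + suc (5 + s + 1)))))))
    ≡ 62 * 1 + 37 * n + 15 * m + 3 * h + 13 * (n * n) + s
  arith = solve-∀
  arith′ : ∀ f → 62 * f + 37 * f + 15 * f + 3 * f + 13 * f + 4608 * f ≡ 4738 * f
  arith′ = solve-∀

-- The product of the class sizes is minimum times maximum, hence at most h n. The constant is 2 *
-- 144 * 16: 2 from the search tree, 144 from a visit, where 144 = 12 + 2 * 2 * 33, and 16 from
-- `cube≤factorial`.
search-time : ∀ {n r b k e} → r ≤ n → b ≤ n → 0 < r ⊓ b → r ⊓ b ≤ e → suc k ≤ e → k < n →
  total k n * (12 + suc r * (suc b * (suc k * 33))) ≤ 4608 * n ^ e
search-time {n} {r} {b} {k} {e} r≤n b≤n 0<h h≤e k<e k<n = begin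
  total k n * (12 + suc r * (suc b * (suc k * 33)))
    ≤⟨ *-mono-≤ (total≤ k n) checking ⟩
  2 * binomials n k * (144 * (h * n * suc k))
    ≡⟨ arith (binomials n k) h n (suc k) ⟩
  288 * (h * (n * (suc k * binomials n k)))
    ≤⟨ *-monoʳ-≤ 288 (search-cost n h k e h≤e k<e 0<h (≤-trans (m⊓n≤m r b) r≤n) k<n) ⟩
  288 * (16 * n ^ e)
    ≡⟨ *-assoc 288 16 (n ^ e) ⟨
  4608 * n ^ e ∎
  where
  open ≤-Reasoning
  h = r ⊓ b
  arith : ∀ c h n s → 2 * c * (144 * (h * n * s)) ≡ 288 * (h * (n * (s * c)))
  arith = solve-∀
  product : ∀ {r b} → r ≤ n → b ≤ n → r * b ≤ r ⊓ b * n
  product {r} {b} r≤n b≤n with ≤-total r b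
  ... | inj₁ r≤b rewrite m≤n⇒m⊓n≡m r≤b = *-monoʳ-≤ r b≤n
  ... | inj₂ b≤r rewrite m≥n⇒m⊓n≡n b≤r = ≤-trans (≤-reflexive (*-comm r b)) (*-monoʳ-≤ b r≤n)
  suc≤ : ∀ {r} → 0 < r → suc r ≤ 2 * r
  suc≤ {suc r} _ = ≤-trans (≤-reflexive (cong suc (sym (+-identityʳ (suc r))))) (s≤s (m≤n+m (suc r + 0) r))
  doubling : ∀ r b s → 2 * r * (2 * b * (s * 33)) ≡ 132 * (r * b * s)
  doubling = solve-∀
  1≤rbs : 1 ≤ r * b * suc k
  1≤rbs = *-mono-≤ (*-mono-≤ (≤-trans 0<h (m⊓n≤m r b)) (≤-trans 0<h (m⊓n≤n r b))) (s≤s (z≤n {k}))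
  checking : 12 + suc r * (suc b * (suc k * 33)) ≤ 144 * (h * n * suc k)
  checking = begin
    12 + suc r * (suc b * (suc k * 33))
      ≤⟨ +-mono-≤ (*-monoʳ-≤ 12 1≤rbs) (*-mono-≤ (suc≤ (≤-trans 0<h (m⊓n≤m r b)))
           (*-monoˡ-≤ (suc k * 33) (suc≤ (≤-trans 0<h (m⊓n≤n r b))))) ⟩
    12 * (r * b * suc k) + 2 * r * (2 * b * (suc k * 33))
      ≡⟨ cong (_+_ (12 * (r * b * suc k))) (doubling r b (suc k)) ⟩
    12 * (r * b * suc k) + 132 * (r * b * suc k)
      ≡⟨ *-distribʳ-+ (r * b * suc k) 12 132 ⟨
    144 * (r * b * suc k)
      ≤⟨ *-monoʳ-≤ 144 (*-monoˡ-≤ (suc k) (product r≤n b≤n)) ⟩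
    144 * (h * n * suc k) ∎

-- The rows of the adjacency matrix start at A and are reached through the
-- table at aT.
Computes : Program → ℕ → ∀ {n} → Graph n → Set
Computes mul d {n} G = ∀ σ A → reg σ rOne ≡ 1 → reg σ ans ≡ 0 → reg σ #V ≡ n →
  (∀ (x : Fin n) → mem σ (reg σ aT + toℕ x) ≡ A + toℕ x * n) →
  (∀ x v → mem σ (A + toℕ x * n + toℕ v) ≡ bit (Neighbourhoods.adjacent G x v)) →
  Runs mul σ (2 + suc n * (suc n * 13)) λ τ → Agree 14 σ τ × mem τ ≡ mem σ × reg τ rMul ≡ d

-- `locates` presupposes an edge: when Δ = 0, no set of size Δ tells a vertex apart from another
-- one. The condition 2 ≤ `mult I` keeps the n² steps spent on the matrix within the bound.
record Multiplier (𝒞 : Instance → Set) (mul : Program) (mult : Instance → ℕ) : Set₁ where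
  field
    computes : ∀ I → 𝒞 I → Computes mul (mult I) (Instance.graph I)
    locates  : ∀ I → 𝒞 I → ∀ u v → Graph._~_ (Instance.graph I) u v →
               2 ≤ mult I × (∀ x → Neighbourhoods.Locatable (Instance.graph I) x (mult I))

-- Correctness and running time on a fixed instance

module Solving (I : Instance) where
  open Instance I using (order; graph; twinFree; colouring; k; edges; minClass; Yes)
  open Graph graph using (_~_; _~?_; ~-sym; ~-irr)
  open Neighbourhoods graph
  open Separation graph colouring

  -- The memory map: red list at 4, blue list at `B₀`, edges at `E₀`. The input ends at `T₀`, where
  -- the table of row addresses is built; the matrix follows at `A₀` and the stack at `A₀ + n * n`.
  n nR nB m B₀ E₀ T₀ A₀ K : ℕ
  n  = order
  nR = length R
  nB = length B
  m  = length edges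
  B₀ = 4 + nR + 1
  E₀ = B₀ + nB + 1
  T₀ = E₀ + m + m
  A₀ = T₀ + n
  K  = magnitude k

  rs bs es ws : List ℕ
  rs = concatMap encodeVertex R
  bs = concatMap encodeVertex B
  es = concatMap encodeEdge edges
  ws = n ∷ signOf k ∷ K ∷ nR ∷ (rs ++ (nB ∷ (bs ++ (m ∷ es))))

  -- With sign and magnitude as separate words, the first four addresses reduce without a case
  -- distinction on k, which is why much of `setup-ready` holds by `refl`.
  encode≡ws : encode I ≡ ws
  encode≡ws = cong (λ z → n ∷ z ++ (nR ∷ (rs ++ (nB ∷ (bs ++ (m ∷ es)))))) (encodeℤ-parts k)

  μ₀ : Addr → ℕ
  μ₀ = contents ws

  tail-rs : ∀ j → μ₀ (4 + nR + j) ≡ contents (nB ∷ (bs ++ (m ∷ es))) j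
  tail-rs j = contents-++ rs (cong (_+ j) (sym (length-encodeVertices R)))

  tail-bs : ∀ j → μ₀ (B₀ + nB + j) ≡ contents (m ∷ es) j
  tail-bs j = trans (cong μ₀ (arith nR nB j)) (trans (tail-rs (suc (nB + j)))
                (contents-++ bs (cong (_+ j) (sym (length-encodeVertices B)))))
    where
    arith : ∀ r b j → 4 + r + 1 + b + j ≡ 4 + r + suc (b + j)
    arith = solve-∀

  lists-R : Lists μ₀ 4 R
  lists-R = lists-move (contents (rs ++ (nB ∷ (bs ++ (m ∷ es))))) μ₀ 0 4 (λ _ _ → refl) (lists-encodeVertices R _)

  lists-B : Lists μ₀ B₀ B
  lists-B = lists-move (contents (bs ++ (m ∷ es))) μ₀ 0 B₀ (λ j _ → trans (cong μ₀ (+-assoc (4 + nR) 1 j)) (tail-rs (suc j)))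
                       (lists-encodeVertices B (m ∷ es))

  lists-edges : ListsEdges μ₀ E₀ edges
  lists-edges = listsEdges-move (contents es) μ₀ 0 E₀ (λ i _ → trans (cong μ₀ (+-assoc (B₀ + nB) 1 i)) (tail-bs (suc i)))
                                (lists-encodeEdges edges)

  beyond : ∀ a → T₀ ≤ a → μ₀ a ≡ 0
  beyond a T≤a = contents-beyond ws a (≤-trans (≤-reflexive len) T≤a)
    where
    arith : ∀ r b m → 4 + (r + suc (b + suc (m + m))) ≡ 4 + r + 1 + b + 1 + m + m
    arith = solve-∀
    len : length ws ≡ T₀
    len = trans (cong (_+_ 4) (trans (length-++ rs) (cong₂ (λ a b → a + suc b) (length-encodeVertices R)
            (trans (length-++ bs) (cong₂ (λ a b → a + suc b) (length-encodeVertices B) (length-encodeEdges edges))))))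
          (arith nR nB m)

  record Ready₀ (σ : State) : Set where
    field
      one  : reg σ rOne ≡ 1
      zer  : reg σ ans ≡ 0
      eV   : reg σ #V ≡ n
      eR   : reg σ #R ≡ nR
      eB   : reg σ #B ≡ nB
      eaR  : reg σ aR ≡ 4
      eaB  : reg σ aB ≡ B₀
      eE   : reg σ #E ≡ m
      eaE  : reg σ aE ≡ E₀
      eT   : reg σ aT ≡ T₀
      eM   : reg σ aM ≡ A₀
      eK   : reg σ rK ≡ K
      eH   : reg σ rH ≡ minClass

  ready₀-agree : ∀ σ τ → Agree 13 σ τ → Ready₀ σ → Ready₀ τ
  ready₀-agree σ τ ag r = record
    { one = trans (same rOne) one ; zer = trans (same ans) zer ; eV = trans (same #V) eV
    ; eR = trans (same #R) eR ; eB = trans (same #B) eB ; eaR = trans (same aR) eaR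
    ; eaB = trans (same aB) eaB ; eE = trans (same #E) eE ; eaE = trans (same aE) eaE
    ; eT = trans (same aT) eT ; eM = trans (same aM) eM ; eK = trans (same rK) eK
    ; eH = trans (same rH) eH }
    where
    open Ready₀ r
    same = kept 13 σ τ ag

  σ₀ : State
  σ₀ = ⟪ (λ _ → 0) , μ₀ ⟫

  setup-ready : Ready₀ (exec setup σ₀)
  setup-ready = record
    { one = refl ; zer = refl ; eV = refl ; eR = refl ; eB = b ; eaR = refl ; eaB = refl
    ; eE = e ; eaE = cong (λ q → B₀ + q + 1) b
    ; eT = t ; eM = cong (_+ n) t
    ; eK = refl ; eH = trans (cong (λ q → nR ∸ (nR ∸ q)) b) (m∸[m∸n]≡m⊓n nR nB) }
    where
    b : μ₀ (4 + nR) ≡ nB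
    b = trans (cong μ₀ (sym (+-identityʳ (4 + nR)))) (tail-rs 0)
    e : μ₀ (B₀ + μ₀ (4 + nR)) ≡ m
    e = trans (cong μ₀ (trans (cong (_+_ B₀) b) (sym (+-identityʳ (B₀ + nB))))) (tail-bs 0)
    t : B₀ + μ₀ (4 + nR) + 1 + μ₀ (B₀ + μ₀ (4 + nR)) + μ₀ (B₀ + μ₀ (4 + nR)) ≡ T₀
    t = cong₂ (λ q q′ → B₀ + q + 1 + q′ + q′) b e

  Answer : State → Set
  Answer τ = (Yes × reg τ ans ≡ 1) ⊎ (¬ Yes × reg τ ans ≡ 0)

  yes⇒separable : signOf k ≡ 0 → Yes → SeparableBy K
  yes⇒separable = go k
    where
    go : ∀ k → signOf k ≡ 0 → (∃[ s ] SepRB graph colouring s × + s ℤ.≤ k) → SeparableBy (magnitude k)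
    go (+ _) _ (_ , ((S , sep , refl) , _) , s≤k) = S , sep , ℤ.drop‿+≤+ s≤k

  separable⇒yes : signOf k ≡ 0 → SeparableBy K → Yes
  separable⇒yes = go k
    where
    go : ∀ k → signOf k ≡ 0 → SeparableBy (magnitude k) → ∃[ s ] SepRB graph colouring s × + s ℤ.≤ k
    go (+ j) _ h with s , p , s≤j ← smallest j h = s , p , ℤ.+≤+ s≤j

  negative⇒no : signOf k ≢ 0 → ¬ Yes
  negative⇒no = go k
    where
    go : ∀ k → signOf k ≢ 0 → ¬ (∃[ s ] SepRB graph colouring s × + s ℤ.≤ k)
    go (+ _)    ne _            = ne refl
    go -[1+ _ ] _  (_ , _ , ())

  edge-listed : ∀ {u v} → u ~ v → (u , v) ∈ edges ⊎ (v , u) ∈ edges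
  edge-listed {u} {v} p with <-cmp (toℕ u) (toℕ v)
  ... | tri< u<v _ _ = inj₁ (∈-filter⁺ _ (∈-cartesianProduct⁺ (∈-allFin u) (∈-allFin v)) (u<v , p))
  ... | tri> _ _ v<u = inj₂ (∈-filter⁺ _ (∈-cartesianProduct⁺ (∈-allFin v) (∈-allFin u)) (v<u , ~-sym p))
  ... | tri≈ _ e _   = ⊥-elim (~-irr (toℕ-injective e) p)

  listed-edge : ∀ {u v} → (u , v) ∈ edges → u ~ v
  listed-edge p = proj₂ (proj₂ (∈-filter⁻ (λ (u , v) → (u Fin.<? v) ×-dec (u ~? v))
                                  {xs = cartesianProduct (allFin n) (allFin n)} p))

  some-edge : m ≢ 0 → ∃[ u ] ∃[ v ] u ~ v
  some-edge m≢0 with edges in e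
  ... | []          = ⊥-elim (m≢0 refl)
  ... | (u , v) ∷ _ = u , v , listed-edge (subst ((u , v) ∈_) (sym e) (here refl))

  no-edge : m ≡ 0 → ∀ u v → ¬ u ~ v
  no-edge m≡0 u v p = [ empty , empty ]′ (edge-listed p)
    where
    empty : ∀ {e} → ¬ e ∈ edges
    empty q = <⇒≱ (∈⇒0<length q) (≤-reflexive m≡0)

  nR≤n : nR ≤ n
  nR≤n = ≤-trans (length-filter _ (allFin n)) (≤-reflexive (length-tabulate id))

  nB≤n : nB ≤ n
  nB≤n = ≤-trans (length-filter _ (allFin n)) (≤-reflexive (length-tabulate id))

  m≤n*n : m ≤ n * n
  m≤n*n = ≤-trans (length-filter _ (cartesianProduct (allFin n) (allFin n)))
    (≤-reflexive (trans (length-cartesianProduct (allFin n) (allFin n))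
      (cong₂ _*_ (length-tabulate {n = n} id) (length-tabulate {n = n} id))))

  Adj Closed : ℕ → ℕ → Set
  Adj u v    = ∃[ x ] ∃[ y ] toℕ x ≡ u × toℕ y ≡ v × x ~ y
  Closed u v = ∃[ x ] ∃[ y ] toℕ x ≡ u × toℕ y ≡ v × (y ≡ x ⊎ x ~ y)

  bit-dec : ∀ {P : Set} {w} (d : Dec P) → (P → w ≡ 1) → (w ≡ 0 ⊎ (w ≡ 1 × P)) → w ≡ bit (does d)
  bit-dec (yes p) one _                = one p
  bit-dec (no ¬p) _   (inj₁ e)         = e
  bit-dec (no ¬p) _   (inj₂ (_ , p))   = ⊥-elim (¬p p)

  adj⁻ : ∀ {x y} → Adj (toℕ x) (toℕ y) → x ~ y
  adj⁻ (_ , _ , e , e′ , p) with refl ← toℕ-injective e with refl ← toℕ-injective e′ = p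

  closed⁻ : ∀ {x y} → Closed (toℕ x) (toℕ y) → y ≡ x ⊎ x ~ y
  closed⁻ (_ , _ , e , e′ , p) with refl ← toℕ-injective e with refl ← toℕ-injective e′ = p

  module _ (σ₁ : State) (r : Ready₀ σ₁)
           (eS : reg σ₁ aS ≡ A₀ + n * n)
           (low : ∀ a → a < T₀ → mem σ₁ a ≡ μ₀ a)
           (rows : ∀ u → u < n → mem σ₁ (T₀ + u) ≡ A₀ + u * n)
           (cells : ∀ x v → mem σ₁ (A₀ + toℕ x * n + toℕ v) ≡ bit (nb x v))
           (sign≡0 : signOf k ≡ 0) (0<h : 0 < minClass) (mult : ℕ)
           (thr : reg σ₁ u₁ ≡ mult * minClass) (1≤mult : 1 ≤ mult)
           (locate : ∀ x → Locatable x mult) where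

    open Ready₀ r
    open Checking graph colouring T₀ A₀ B₀

    private
      S₀ : ℕ
      S₀ = A₀ + n * n
      T₀≤S₀ : T₀ ≤ S₀
      T₀≤S₀ = ≤-trans (m≤m+n T₀ n) (m≤m+n A₀ (n * n))

    -- Besides the stack itself, everything that a test reads lies below `S₀`, so readiness survives
    -- every push.
    ready-below : ∀ μ → (∀ a → a < S₀ → μ a ≡ mem σ₁ a) → Ready μ
    ready-below μ h = record
      { reds  = lists-move μ₀ μ 4 4 (λ j j<R → input (4 + j) (≤-trans (+-monoʳ-< 4 j<R) 4+nR≤T₀)) lists-R
      ; blues = lists-move μ₀ μ B₀ B₀ (λ j j<B → input (B₀ + j) (≤-trans (+-monoʳ-< B₀ j<B) B₀+nB≤T₀)) lists-B
      ; rows  = λ x → trans (h _ (<-≤-trans (+-monoʳ-< T₀ (toℕ<n x)) (m≤m+n A₀ (n * n)))) (rows (toℕ x) (toℕ<n x))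
      ; cells = λ x v → trans (h _ (cell-in x v)) (cells x v) }
      where
      input : ∀ a → a < T₀ → μ a ≡ μ₀ a
      input a a<T = trans (h a (<-≤-trans a<T T₀≤S₀)) (low a a<T)
      B₀+nB≤T₀ : B₀ + nB ≤ T₀
      B₀+nB≤T₀ = ≤-trans (m≤m+n _ 1) (≤-trans (m≤m+n E₀ m) (m≤m+n _ m))
      4+nR≤T₀ : 4 + nR ≤ T₀
      4+nR≤T₀ = ≤-trans (m≤m+n (4 + nR) 1) (≤-trans (m≤m+n B₀ nB) B₀+nB≤T₀)
      cell-in : ∀ (x v : Fin n) → A₀ + toℕ x * n + toℕ v < S₀
      cell-in x v = begin-strict
        A₀ + toℕ x * n + toℕ v   <⟨ +-monoʳ-< (A₀ + toℕ x * n) (toℕ<n v) ⟩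
        A₀ + toℕ x * n + n       ≡⟨ trans (+-assoc A₀ _ n) (cong (_+_ A₀) (+-comm (toℕ x * n) n)) ⟩
        A₀ + suc (toℕ x) * n     ≤⟨ +-monoʳ-≤ A₀ (*-monoˡ-≤ n (toℕ<n x)) ⟩
        S₀                       ∎
        where open ≤-Reasoning

    ready : Ready (mem σ₁)
    ready = ready-below (mem σ₁) λ _ _ → refl

    chk : List ℕ → Bool
    chk = separatesIn (mem σ₁) T₀ 4 nR B₀ nB

    -- The two tests read different memories. They agree because each is equivalent to the same
    -- statement about graph and list: every red-blue pair is told apart by a vertex of `L`.
    chk-correct : ∀ σ L → Agree 16 σ₁ σ → (∀ a → a < reg σ₁ aS → mem σ a ≡ mem σ₁ a) →
                  All (_< reg σ₁ #V) L → reg σ lvl ≡ length L →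
                  arr (mem σ) (reg σ₁ aS) (length L) ≡ L → checked σ ≡ chk L
    chk-correct σ L ag below L<n lv st = trans unfolded (iff-≡
        (λ e → separatesIn-complete ready L L<n′ (separatesIn-sound ready′ L L<n′ e))
        (λ e → separatesIn-complete ready′ L L<n′ (separatesIn-sound ready L L<n′ e)))
      where
      same = kept 16 σ₁ σ ag
      L<n′ : All (_< n) L
      L<n′ = subst (λ q → All (_< q) L) eV L<n
      ready′ : Ready (mem σ)
      ready′ = ready-below (mem σ) λ a a<S → below a (subst (a <_) (sym eS) a<S)
      unfolded : checked σ ≡ separatesIn (mem σ) T₀ 4 nR B₀ nB L
      unfolded rewrite same aT {_} | same aR {_} | same #R {_} | same aB {_} | same #B {_} | same aS {_}
                     | lv | st | eT | eaR | eR | eaB | eB = refl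

    -- The time bound on the search is asked for only under `K < mult * minClass` and `K < n`, which
    -- is what the failure of the two preceding tests provides.
    decide-runs : ∀ s → (K < mult * minClass → K < n →
                         total K n * (12 + suc nR * (suc nB * (suc K * 33))) ≤ s) →
                  Runs decide σ₁ (1 + suc (1 + suc (5 + s + 1))) Answer
    decide-runs s time =
      block {P = tmp ≔ u₁ ⊖ rK} {Q = λ τ → τ ≡ τ₁} refl then λ { _ refl → branch
        (λ z → within (s≤s z≤n) (block {P = ans ≔ 1} (inj₁
          (separable⇒yes sign≡0 (bounded (m∸n≡0⇒m≤n (trans (sym (cong₂ _∸_ thr eK)) z))) , refl))))
        (λ nz → block {P = tmp ≔ #V ⊖ rK} {Q = λ τ → τ ≡ τ₂} refl then λ { _ refl → branch
          (λ z → within (m≤n+m 1 (5 + s)) (block {P = ans ≔ 1} (inj₁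
            (separable⇒yes sign≡0 (all-vertices (m∸n≡0⇒m≤n (trans (sym (cong₂ _∸_ eV eK)) z))) , refl))))
          (λ nz′ → within (+-monoˡ-≤ 1 (+-monoʳ-≤ 5 (time′ nz nz′)))
             (searched then λ τ (za , f) → block {P = ans ≔ found ⊕ ans} (answered τ za f))) }) }
      where
      τ₁ τ₂ : State
      τ₁ = exec (tmp ≔ u₁ ⊖ rK) σ₁
      τ₂ = exec (tmp ≔ #V ⊖ rK) τ₁
      minimum : SeparableBy (mult * minClass)
      minimum = separating-≤ locate
      bounded : mult * minClass ≤ K → SeparableBy K
      bounded le with S , sep , S≤ ← minimum = S , sep , ≤-trans S≤ le
      -- Some separating set exists by `minimum`, and no subset has more than n elements.
      all-vertices : n ≤ K → SeparableBy K
      all-vertices le with S , sep , _ ← minimum = S , sep , ≤-trans (∣p∣≤n S) le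
      larger : ∀ {a b} → a ∸ b ≢ 0 → b < a
      larger {a} {b} ne = ≰⇒> λ a≤b → ne (m≤n⇒m∸n≡0 a≤b)
      module Loop = Search τ₂ chk one zer chk-correct
      searched : Runs search τ₂ (5 + total (reg σ₁ rK) (reg σ₁ #V) * Loop.K) λ τ →
        reg τ ans ≡ 0 × reg τ found ≡ bit (foundFrom chk (reg σ₁ rK) (reg σ₁ #V) [])
      searched = Loop.search-runs
      time′ : reg σ₁ u₁ ∸ reg σ₁ rK ≢ 0 → reg σ₁ #V ∸ reg σ₁ rK ≢ 0 →
              total (reg σ₁ rK) (reg σ₁ #V) *
                (12 + suc (reg σ₁ #R) * (suc (reg σ₁ #B) * (suc (reg σ₁ rK) * 33))) ≤ s
      time′ nz nz′ rewrite eK | eV | eR | eB | thr = time (larger nz) (larger nz′)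
      answered : ∀ τ → reg τ ans ≡ 0 → reg τ found ≡ bit (foundFrom chk (reg σ₁ rK) (reg σ₁ #V) []) →
                 (Yes × reg τ found + reg τ ans ≡ 1) ⊎ (¬ Yes × reg τ found + reg τ ans ≡ 0)
      answered τ za f rewrite eK | eV | za with foundFrom chk K n [] in e
      ... | true  = inj₁ (separable⇒yes sign≡0 (found⇒separable ready K e) , trans (+-identityʳ _) f)
      ... | false = inj₂ ((λ y → bool-contra (separable⇒found ready K (yes⇒separable sign≡0 y)) e) , trans (+-identityʳ _) f)

  module _ {𝒞 : Instance → Set} {mul : Program} {mult : Instance → ℕ} (M : Multiplier 𝒞 mul mult) (I∈𝒞 : 𝒞 I) where
    open Multiplier M

    private
      e f : ℕ
      e = mult I * minClass
      f = n ^ e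

    module _ (sign≡0 : signOf k ≡ 0) (h≢0 : minClass ≢ 0) (m≢0 : m ≢ 0) where

      0<h : 0 < minClass
      0<h = n≢0⇒n>0 h≢0

      2≤mult : 2 ≤ mult I
      2≤mult with u , v , p ← some-edge m≢0 = proj₁ (locates I I∈𝒞 u v p)

      locate : ∀ x → Locatable x (mult I)
      locate with u , v , p ← some-edge m≢0 = proj₂ (locates I I∈𝒞 u v p)

      h≤n : minClass ≤ n
      h≤n = ≤-trans (m⊓n≤m nR nB) nR≤n

      h≤e : minClass ≤ e
      h≤e = ≤-trans (≤-reflexive (sym (+-identityʳ minClass))) (*-monoˡ-≤ minClass (<⇒≤ 2≤mult))

      n≢0 : NonZero n
      n≢0 = >-nonZero (≤-trans 0<h h≤n)

      n*n≤f : n * n ≤ f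
      n*n≤f = ≤-trans (≤-reflexive (cong (_*_ n) (sym (*-identityʳ n))))
                (^-monoʳ-≤ n {{n≢0}} (*-mono-≤ 2≤mult 0<h))

      n≤f : n ≤ f
      n≤f = ≤-trans (m≤m*n n n {{n≢0}}) n*n≤f

      1≤f : 1 ≤ f
      1≤f = ≤-trans 0<h (≤-trans h≤n n≤f)

      s : ℕ
      s = 4608 * f

      time : K < e → K < n → total K n * (12 + suc nR * (suc nB * (suc K * 33))) ≤ s
      time = search-time nR≤n nB≤n 0<h h≤e

      module Open   = Matrix n T₀ A₀ ≤-refl Adj
      module Closed′ = Matrix n T₀ A₀ ≤-refl Closed

      record Built (μ : Addr → ℕ) : Set where
        field
          low  : ∀ a → a < T₀ → μ a ≡ μ₀ a
          rows : ∀ u → u < n → μ (T₀ + u) ≡ A₀ + u * n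

      from-diagonal : ∀ σ → Ready₀ σ → reg σ aS ≡ A₀ + n * n → reg σ rMul ≡ mult I → Built (mem σ) →
        (∀ x v → mem σ (A₀ + toℕ x * n + toℕ v) ≡ bit (does (x ~? v))) →
        Runs (fillDiagonal ⨾ threshold ⨾ decide) σ
          ((1 + suc n * 6) + ((2 + suc minClass * 3) + (1 + suc (1 + suc (5 + s + 1))))) Answer
      from-diagonal σ r eS eMul built cells =
        Closed′.fillDiagonal-runs (mem σ) rows σ one zer eV eT
          (Closed′.filled (λ _ _ → refl) sound)
          (λ u u<n → fromℕ< u<n , fromℕ< u<n , toℕ-fromℕ< u<n , toℕ-fromℕ< u<n , inj₁ refl)
        then λ { σ₁ (ag₁ , F₁ , keeps , diag) →
          let r₁ = ready₀-agree σ σ₁ (agree-fewer 7 13 σ σ₁ ag₁) r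
          in within (+-monoˡ-≤ _ (≤-reflexive (cong (λ q → 2 + suc q * 3) (Ready₀.eH r₁))))
            (threshold-runs σ₁ (Ready₀.one r₁) (Ready₀.zer r₁)
        then λ { σ₂ (ag₂ , m₂ , thr) →
          let r₂ = ready₀-agree σ₁ σ₂ (agree-fewer 7 13 σ₁ σ₂ ag₂) r₁
              same₂ = kept 20 σ₁ σ₂ ag₂
              same₁ = kept 20 σ σ₁ ag₁
              below : ∀ a → a < A₀ → mem σ₂ a ≡ mem σ a
              below a a<A = trans (cong (λ μ → μ a) m₂) (Closed′.Filled.below F₁ a a<A)
          in decide-runs σ₂ r₂ (trans (same₂ aS) (trans (same₁ aS) eS))
               (λ a a<T → trans (below a (<-≤-trans a<T (m≤m+n T₀ n))) (low a a<T))
               (λ u u<n → trans (below (T₀ + u) (+-monoʳ-< T₀ u<n)) (rows u u<n))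
               (λ x v → trans (cong (λ μ → μ (A₀ + toℕ x * n + toℕ v)) m₂)
                  (bit-dec ((v Fin.≟ x) ⊎-dec (x ~? v)) (here-one σ₁ keeps diag)
                    (Sum.map₂ (λ (q , c) → q , closed⁻ c) (Closed′.Filled.sound F₁ (toℕ x) (toℕ v) (toℕ<n x) (toℕ<n v)))))
               sign≡0 0<h (mult I)
               (trans thr (cong₂ _*_ (trans (same₁ rMul) eMul) (Ready₀.eH r₁)))
               (<⇒≤ 2≤mult) locate s time }) }
        where
        open Ready₀ r
        open Built built
        sound : ∀ u v → u < n → v < n →
          mem σ (A₀ + u * n + v) ≡ 0 ⊎ (mem σ (A₀ + u * n + v) ≡ 1 × Closed u v)
        sound u v u<n v<n with x ← fromℕ< u<n in ex | y ← fromℕ< v<n in ey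
          with refl ← trans (sym (toℕ-fromℕ< u<n)) (cong toℕ ex) | refl ← trans (sym (toℕ-fromℕ< v<n)) (cong toℕ ey)
          with x ~? y | cells x y
        ... | yes p | q = inj₂ (q , x , y , refl , refl , inj₂ p)
        ... | no _  | q = inj₁ q
        here-one : ∀ σ₁ → (∀ c → mem σ c ≡ 1 → mem σ₁ c ≡ 1) →
                   (∀ u → u < n → mem σ₁ (A₀ + u * n + u) ≡ 1) → ∀ {x v} → v ≡ x ⊎ x ~ v →
                   mem σ₁ (A₀ + toℕ x * n + toℕ v) ≡ 1
        here-one σ₁ keeps diag {x} (inj₁ refl)   = diag (toℕ x) (toℕ<n x)
        here-one σ₁ keeps diag {x} {v} (inj₂ p) = keeps _ (trans (cells x v) (cong bit (dec-true (x ~? v) p)))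

      from-table : ∀ σ → Ready₀ σ → mem σ ≡ μ₀ →
        Runs (table ⨾ fillEdges ⨾ mul ⨾ fillDiagonal ⨾ threshold ⨾ decide) σ (5000 * f) Answer
      from-table σ r m₀ =
        within (solving-time 1≤f n≤f (≤-trans m≤n*n n*n≤f) (≤-trans h≤n n≤f) n*n≤f (≤-refl {s}))
        (within (+-monoˡ-≤ _ (≤-reflexive (cong (λ q → 4 + suc q * 5) eV)))
        (table-runs σ one zer
        then λ { σ₁ (ag₁ , eS₁ , tab , oth) → after-table σ₁ (ready₀-agree σ σ₁ ag₁ r)
          (trans eS₁ (cong₂ (λ a q → a + q * q) eM eV))
          (record
            { low  = λ a a<T → trans (oth a (inj₁ (subst (a <_) (sym eT) a<T))) (cong (λ μ → μ a) m₀)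
            ; rows = λ u u<n → trans (cong (λ t → mem σ₁ (t + u)) (sym eT))
                (trans (tab u (subst (u <_) (sym eV) u<n)) (cong₂ (λ a q → a + u * q) eM eV)) })
          (λ a A≤a → trans (oth a (inj₂ (≤-trans (≤-reflexive (cong₂ _+_ eT eV)) A≤a)))
             (trans (cong (λ μ → μ a) m₀) (beyond a (≤-trans (m≤m+n T₀ n) A≤a)))) }))
        where
        open Ready₀ r
        after-table : ∀ σ₁ → Ready₀ σ₁ → reg σ₁ aS ≡ A₀ + n * n → Built (mem σ₁) →
          (∀ a → A₀ ≤ a → mem σ₁ a ≡ 0) →
          Runs (fillEdges ⨾ mul ⨾ fillDiagonal ⨾ threshold ⨾ decide) σ₁
            ((1 + suc m * 15) + ((2 + suc n * (suc n * 13)) + ((1 + suc n * 6) +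
              ((2 + suc minClass * 3) + (1 + suc (1 + suc (5 + s + 1))))))) Answer
        after-table σ₁ r₁ eS built blank =
          within (+-monoˡ-≤ _ (≤-reflexive (cong (λ q → 1 + suc q * 15) (Ready₀.eE r₁))))
          (Open.fillEdges-runs (mem σ₁) rows σ₁ (Ready₀.one r₁) (Ready₀.zer r₁) (Ready₀.eV r₁) (Ready₀.eT r₁)
            -- The matrix needs no clearing: memory beyond the input is 0, and the table of row
            -- addresses ends at `A₀`.
            (Open.filled (λ _ _ → refl) (λ u v _ _ → inj₁ (blank _ (≤-trans (m≤m+n A₀ (u * n)) (m≤m+n _ v)))))
            (≤-trans (≤-reflexive (cong₂ (λ a q → a + q + q) (Ready₀.eaE r₁) (Ready₀.eE r₁))) (m≤m+n T₀ n))
            (subst₂ Ends (sym (Ready₀.eaE r₁)) (sym (Ready₀.eE r₁)) ends)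
          then λ { σ₂ (ag₂ , F₂ , marks) →
            let r₂ = ready₀-agree σ₁ σ₂ (agree-fewer 7 13 σ₁ σ₂ ag₂) r₁
                marks′ = subst₂ (Marked (mem σ₂)) (Ready₀.eaE r₁) (Ready₀.eE r₁) marks
                built₂ : Built (mem σ₂)
                built₂ = record
                  { low  = λ a a<T → trans (Open.Filled.below F₂ a (<-≤-trans a<T (m≤m+n T₀ n))) (low a a<T)
                  ; rows = λ u u<n → trans (Open.Filled.below F₂ (T₀ + u) (+-monoʳ-< T₀ u<n)) (rows u u<n) }
                cells₂ = λ x v → bit-dec (x ~? v) (edge-one σ₂ marks′)
                  (Sum.map₂ (λ (q , c) → q , adj⁻ c) (Open.Filled.sound F₂ (toℕ x) (toℕ v) (toℕ<n x) (toℕ<n v)))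
            in computes I I∈𝒞 σ₂ A₀ (Ready₀.one r₂) (Ready₀.zer r₂) (Ready₀.eV r₂)
                 (λ x → trans (cong (λ t → mem σ₂ (t + toℕ x)) (Ready₀.eT r₂)) (Built.rows built₂ (toℕ x) (toℕ<n x)))
                 cells₂
          then λ { σ₃ (ag₃ , m₃ , eMul) →
            from-diagonal σ₃ (ready₀-agree σ₂ σ₃ (agree-fewer 1 13 σ₂ σ₃ ag₃) r₂)
              (trans (kept 14 σ₂ σ₃ ag₃ aS) (trans (kept 20 σ₁ σ₂ ag₂ aS) eS)) eMul
              (subst Built (sym m₃) built₂)
              (λ x v → trans (cong (λ μ → μ (A₀ + toℕ x * n + toℕ v)) m₃) (cells₂ x v)) } })
          where
          open Built built
          μ₁ = mem σ₁
          Ends : Addr → ℕ → Set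
          Ends E m = ∀ j → j < m → let a = μ₁ (E + j + j) ; b = μ₁ (E + j + j + 1) in
            a < n × b < n × Adj a b × Adj b a
          Marked : (Addr → ℕ) → Addr → ℕ → Set
          Marked μ E m = ∀ j → j < m → let a = μ₁ (E + j + j) ; b = μ₁ (E + j + j + 1) in
            μ (A₀ + a * n + b) ≡ 1 × μ (A₀ + b * n + a) ≡ 1
          listed : ListsEdges μ₁ E₀ edges
          listed = listsEdges-move μ₀ μ₁ E₀ E₀ (λ i i<2m → low (E₀ + i)
            (<-≤-trans (+-monoʳ-< E₀ i<2m) (≤-reflexive (sym (+-assoc E₀ m m))))) lists-edges
          ends : Ends E₀ m
          ends j j<m with u , v , p , eu , ev ← proj₁ listed j j<m rewrite eu | ev =
            toℕ<n u , toℕ<n v , (u , v , refl , refl , listed-edge p) , (v , u , refl , refl , ~-sym (listed-edge p))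
          edge-one : ∀ σ₂ → Marked (mem σ₂) E₀ m → ∀ {x v} → x ~ v → mem σ₂ (A₀ + toℕ x * n + toℕ v) ≡ 1
          edge-one σ₂ marks {x} {v} p with edge-listed p
          ... | inj₁ q with j , j<m , eu , ev ← proj₂ listed x v q =
            subst₂ (λ a b → mem σ₂ (A₀ + a * n + b) ≡ 1) eu ev (proj₁ (marks j j<m))
          ... | inj₂ q with j , j<m , eu , ev ← proj₂ listed v x q =
            subst₂ (λ a b → mem σ₂ (A₀ + b * n + a) ≡ 1) eu ev (proj₂ (marks j j<m))

    -- For order 0 the colour classes are empty, so the exponent vanishes and `0 ^ 0` is 1.
    1≤n^e : 1 ≤ f
    1≤n^e with minClass ≟ 0
    ... | yes h≡0 rewrite h≡0 | *-zeroʳ (mult I) = ≤-refl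
    ... | no h≢0 = m^n>0 n {{>-nonZero (≤-trans (n≢0⇒n>0 h≢0) (≤-trans (m⊓n≤m nR nB) nR≤n))}} e

    solver-runs : Runs (solver mul) σ₀ (6000 * f) Answer
    solver-runs =
      within total-time
      (block {P = setup} {Q = λ τ → τ ≡ τ₀} refl then λ { _ refl → branch
        (λ sign≡0 → branch
          (λ h≡0 → within 1≤5000f (block {P = ans ≔ 1} (inj₁
            (separable⇒yes sign≡0 (one-class (trans (sym eH) h≡0)) , refl))))
          (λ h≢0 → branch
            (λ m≡0 → within (≤-trans (s≤s (s≤s (s≤s z≤n))) 3≤) (no-edges sign≡0 (trans (sym eE) m≡0)))
            (λ m≢0 → within (m≤n+m (5000 * f) 3)
              (from-table sign≡0 (h≢0 ∘ trans eH) (m≢0 ∘ trans eE) τ₀ setup-ready refl))))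
        (λ sign≢0 → within (s≤s z≤n) (block {P = skip} (inj₂ (negative⇒no sign≢0 , refl)))) })
      where
      τ₀ : State
      τ₀ = exec setup σ₀
      open Ready₀ setup-ready
      3≤ : 3 ≤ 3 + 5000 * f
      3≤ = m≤m+n 3 _
      1≤5000f : 1 ≤ suc (3 + 5000 * f)
      1≤5000f = s≤s z≤n
      -- The constant part consists of 19 set-up steps, three branches and 3 steps for the edgeless
      -- case; these 25 steps are covered by 1000 f since f ≥ 1.
      total-time : 19 + suc (suc (suc (3 + 5000 * f))) ≤ 6000 * f
      total-time = ≤-trans (+-monoˡ-≤ (5000 * f) (≤-trans (≤ᵇ⇒≤ 25 1000 tt) (*-monoʳ-≤ 1000 1≤n^e)))
                           (≤-reflexive (sym (*-distribʳ-+ f 1000 5000)))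
      -- With a class empty there is no pair to split, so the empty set is separating.
      one-class : minClass ≡ 0 → SeparableBy K
      one-class h≡0 with S , sep , S≤ ← separating-list [] (λ r b cr cb →
          ⊥-elim (m⊓n≡0⇒ (∈⇒0<length (∈-class cr)) (∈⇒0<length (∈-class cb)) h≡0)) =
        S , sep , ≤-trans S≤ z≤n
      no-edges : signOf k ≡ 0 → m ≡ 0 → Runs edgeless τ₀ 3 Answer
      no-edges sign≡0 m≡0 =
        block {P = tmp ≔ rH ⊖ rK} {Q = λ τ → τ ≡ exec (tmp ≔ rH ⊖ rK) τ₀} refl then λ { _ refl → branch
          (λ z → block {P = ans ≔ 1} (inj₁
            (separable⇒yes sign≡0 (enough (m∸n≡0⇒m≤n (trans (sym (cong₂ _∸_ eH eK)) z))) , refl)))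
          (λ nz → block {P = skip} (inj₂ ((λ y → case yes⇒separable sign≡0 y of λ
            { (S , sep , S≤K) → nz (trans (cong₂ _∸_ eH eK)
                (m≤n⇒m∸n≡0 (≤-trans (edgeless-≤ (no-edge m≡0) S sep) S≤K))) }) , zer))) }
        where
        enough : minClass ≤ K → SeparableBy K
        -- Without neighbours, x alone is a locating set, which gives the factor 1 in place of d.
        enough h≤K with S , sep , S≤ ← separating-≤ {1} (λ x → x ∷ [] , ≤-refl ,
            λ y y≢x → x , here refl , by-itself y≢x (no-edge m≡0 x y)) =
          S , sep , ≤-trans S≤ (≤-trans (≤-reflexive (+-identityʳ minClass)) h≤K)

    runsWithin : RunsWithin (solver mul) I (6000 * f)
    runsWithin = go (subst (λ ws → Runs (solver mul) ⟪ (λ _ → 0) , contents ws ⟫ (6000 * f) Answer)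
                           (sym encode≡ws) solver-runs)
      where
      go : Runs (solver mul) (initial I) (6000 * f) Answer → RunsWithin (solver mul) I (6000 * f)
      go (runs r b a) = record
        { run = r ; bounded = b
        ; accepts = λ y → [ proj₂ , (λ (¬y , _) → ⊥-elim (¬y y)) ]′ a
        ; rejects = λ ¬y → [ (λ (y , _) → ⊥-elim (¬y y)) , proj₂ ]′ a }

-- The two bounds

solvable : ∀ {𝒞 mul mult} → Multiplier 𝒞 mul mult →
           RedBlueSeparationOn 𝒞 SolvableInO (λ I → Instance.order I ^ (mult I * Instance.minClass I))
solvable {mul = mul} M = solver mul , 6000 , λ I I∈𝒞 → Solving.runsWithin I M I∈𝒞

three : Multiplier Instance.TriangleFree (rMul ≔ 3) (λ _ → 3)
three = record
  { computes = λ I _ σ _ _ _ _ _ _ → within (s≤s z≤n) (block {P = rMul ≔ 3} (agree-refl 14 σ , refl , refl))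
  ; locates  = λ I tf _ _ _ → s≤s (s≤s z≤n) ,
      Neighbourhoods.locate-triangleFree (Instance.graph I) (Instance.twinFree I) tf }

largestDegree-computes : ∀ {n} (G : Graph n) → Computes largestDegree (Graph.maxDegree G) G
largestDegree-computes {n} G σ A e₁ e₀ eV rows cells =
  within (≤-reflexive (cong (λ q → 2 + suc q * (suc q * 13)) eV))
  (weaken (λ τ (ag , m , e) → ag , m , trans e (trans (cong (λ q → maxBelow (λ u → sumBelow (entry u) q) q) eV) maximum))
    (largestDegree-runs σ e₁ e₀))
  where
  open Graph G
  open Neighbourhoods G
  entry : ℕ → ℕ → ℕ
  entry u v = mem σ (mem σ (reg σ aT + u) + v)
  maximum : maxBelow (λ u → sumBelow (entry u) n) n ≡ maxDegree
  maximum = maxBelow-foldr _ degree id λ x →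
    trans (sumBelow-count (entry (toℕ x)) (adjacent x) λ v →
             trans (cong (λ a → mem σ (a + toℕ v)) (rows x)) (cells x v))
          (sym (degree≡count x))

largest : Multiplier (λ _ → ⊤) largestDegree Instance.maxDegree
largest = record
  { computes = λ I _ → largestDegree-computes (Instance.graph I)
  ; locates  = λ I _ u v p →
      Neighbourhoods.2≤maxDegree (Instance.graph I) (Instance.twinFree I) p ,
      Neighbourhoods.locate-maxDegree (Instance.graph I) (Instance.twinFree I)
        (Neighbourhoods.2≤maxDegree (Instance.graph I) (Instance.twinFree I) p) }

theorem7 : (RedBlueSeparationOn Instance.TriangleFree
    SolvableInO (λ I → Instance.order I ^ (3 * Instance.minClass I)))
    ×
    (RedBlueSeparationOn (λ _ → ⊤)
    SolvableInO (λ I → Instance.order I ^ (Instance.maxDegree I * Instance.minClass I)))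
theorem7 = solvable three , solvable largest
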